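{- As $n\to\infty$, the threshold bias of the (original, non-budget) $(1:q)$ $K_4$-Game on $K_n$ satisfies $$q_{K_4}(n)\le\left(5^{6/5}\,2^{ -9/5}e^{2/5}+o(1)\right)n^{2/5}.$$
   Context: The $(1:q)$ $K_4$-Game on the complete graph $K_n$ is played by Maker and Breaker. In each round, Maker first claims one previously unclaimed edge of $K_n$, whereafter Breaker claims $q$ previously unclaimed edges of $K_n$ (unless fewer than $q$ unclaimed edges remain, in which case he claims all remaining edges). Maker wins if at some point she has claimed all six edges of a copy of $K_4$ in $K_n$. Breaker wins if he has claimed at least one edge of each copy of $K_4$ in $K_n$. The threshold bias $q_{K_4}(n)$ is the smallest non-negative integer $q$ such that Breaker has a winning strategy in this game. Here $e$ denotes Euler's number. -}

module Defs where

open import Data.Empty using (⊥-elim)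
open import Data.Fin.Base as Fin using (Fin)
open import Data.Integer.Base as ℤ using (+_; +[1+_]; -[1+_])
import Data.Integer.Properties as ℤₚ
open import Data.List.Base using (List; []; _∷_; _++_; length)
open import Data.List.Membership.Propositional using (_∈_)
open import Data.List.Relation.Unary.All using (All)
open import Data.List.Relation.Unary.Any using (Any)
open import Data.List.Relation.Unary.Unique.Propositional using (Unique)
open import Data.Nat.Base as ℕ using (ℕ; zero; suc; z≤n; s≤s; _!)
import Data.Nat.Properties as ℕₚ
open import Data.Product using (Σ; Σ-syntax; ∃; ∃-syntax; _×_; _,_; proj₁; proj₂)
open import Data.Rational.Base hiding (round)
open import Data.Rational.Properties
open import Data.Rational.Solver using (module +-*-Solver)
import Data.Rational.Unnormalised.Base as ℚᵘ
import Data.Rational.Unnormalised.Properties as ℚᵘₚ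
open import Data.Sum.Base using (_⊎_; inj₁; inj₂)
open import Relation.Binary.PropositionalEquality
open import Relation.Nullary using (¬_; Dec; yes; no)

module Rat where

  open +-*-Solver using (solve; _:=_; _:+_; _:*_; :-_; con)

  cancelˡ : ∀ a b → a + (b - a) ≡ b
  cancelˡ = solve 2 (λ a b → a :+ (b :+ (:- a)) := b) refl

  diff-pos : ∀ {a b} → a < b → 0ℚ < b - a
  diff-pos {a} {b} a<b = subst (_< b - a) (+-inverseʳ a) (+-monoˡ-< (- a) a<b)

  +-pos : ∀ a {d} → 0ℚ < d → a < a + d
  +-pos a {d} 0<d = subst (_< a + d) (+-identityʳ a) (+-monoʳ-< a 0<d)

  *-mono-≤₀ : ∀ {a b c d} → 0ℚ ≤ a → a ≤ b → 0ℚ ≤ c → c ≤ d → a * c ≤ b * d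
  *-mono-≤₀ {a} {b} {c} {d} 0≤a a≤b 0≤c c≤d =
    ≤-trans (*-monoʳ-≤-nonNeg c {{nonNegative 0≤c}} a≤b)
            (*-monoˡ-≤-nonNeg b {{nonNegative (≤-trans 0≤a a≤b)}} c≤d)

  *-nonneg : ∀ {a b} → 0ℚ ≤ a → 0ℚ ≤ b → 0ℚ ≤ a * b
  *-nonneg {a} {b} 0≤a 0≤b = subst (_≤ a * b) (*-zeroˡ 0ℚ) (*-mono-≤₀ ≤-refl 0≤a ≤-refl 0≤b)

  *-pos : ∀ {a b} → 0ℚ < a → 0ℚ < b → 0ℚ < a * b
  *-pos {a} {b} 0<a 0<b =
    subst (_< a * b) (*-zeroˡ b) (*-monoˡ-<-pos b {{positive 0<b}} 0<a)

  *-mono-< : ∀ {a b c d} → 0ℚ ≤ a → a < b → 0ℚ ≤ c → c < d → a * c < b * d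
  *-mono-< {a} {b} {c} {d} 0≤a a<b 0≤c c<d =
    ≤-<-trans (*-monoʳ-≤-nonNeg c {{nonNegative 0≤c}} (<⇒≤ a<b))
              (*-monoʳ-<-pos b {{positive (≤-<-trans 0≤a a<b)}} c<d)

  1ℚ>0 : 0ℚ < 1ℚ
  1ℚ>0 = positive⁻¹ 1ℚ

  shrink : ∀ {k d} → 0ℚ < k → 0ℚ < d → ∃[ δ ] 0ℚ < δ × δ ≤ 1ℚ × δ * k ≤ d
  shrink {k} {d} 0<k 0<d = δ , 0<δ , p⊓q≤p 1ℚ q ,
    ≤-trans (*-monoʳ-≤-nonNeg k {{nonNegative (<⇒≤ 0<k)}} (p⊓q≤q 1ℚ q)) (≤-reflexive eq)
    where
    instance
      k-pos : Positive k
      k-pos = positive 0<k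
      k-nz : NonZero k
      k-nz = pos⇒nonZero k
    q δ : ℚ
    q = d * 1/ k
    δ = 1ℚ ⊓ q
    0<δ : 0ℚ < δ
    0<δ with ⊓-sel 1ℚ q
    ... | inj₁ e = subst (0ℚ <_) (sym e) 1ℚ>0
    ... | inj₂ e = subst (0ℚ <_) (sym e)
                     (*-pos 0<d (positive⁻¹ (1/ k) {{1/pos⇒pos k}}))
    eq : q * k ≡ d
    eq = trans (*-assoc d (1/ k) k)
               (trans (cong (d *_) (*-inverseˡ k)) (*-identityʳ d))

  frac≃ : ∀ n d .{{_ : ℕ.NonZero d}} → toℚᵘ (n / d) ℚᵘ.≃ (n ℚᵘ./ d)
  frac≃ n (suc d) = toℚᵘ-fromℚᵘ (ℚᵘ.mkℚᵘ n d)

  ≤-frac : ∀ a b c d .{{_ : ℕ.NonZero b}} .{{_ : ℕ.NonZero d}} →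
           a ℕ.* d ℕ.≤ c ℕ.* b → + a / b ≤ + c / d
  ≤-frac a (suc b) c (suc d) h = toℚᵘ-cancel-≤
    (ℚᵘₚ.≤-trans (ℚᵘₚ.≤-reflexive (toℚᵘ-fromℚᵘ (ℚᵘ.mkℚᵘ (+ a) b)))
    (ℚᵘₚ.≤-trans (ℚᵘ.*≤* (subst₂ ℤ._≤_ (ℤₚ.pos-* a (suc d)) (ℤₚ.pos-* c (suc b)) (ℤ.+≤+ h)))
                 (ℚᵘₚ.≤-reflexive (ℚᵘₚ.≃-sym (toℚᵘ-fromℚᵘ (ℚᵘ.mkℚᵘ (+ c) d))))))

  frac-pos : ∀ b .{{_ : ℕ.NonZero b}} → 0ℚ < + 1 / b
  frac-pos b = positive⁻¹ (+ 1 / b) {{normalize-pos 1 b}}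

  frac-half : ∀ b .{{_ : ℕ.NonZero b}} .{{_ : ℕ.NonZero (2 ℕ.* b)}} →
              + 1 / (2 ℕ.* b) + + 1 / (2 ℕ.* b) ≤ + 1 / b
  frac-half b = ≤-reflexive (begin
    x + x               ≡⟨ dbl x ⟩
    (+ 2 / 1) * x       ≡⟨ toℚᵘ-injective step ⟩
    + 1 / b             ∎)
    where
    open ≡-Reasoning
    x : ℚ
    x = + 1 / (2 ℕ.* b)
    dbl : ∀ y → y + y ≡ (+ 2 / 1) * y
    dbl = solve 1 (λ y → y :+ y := con (+ 2 / 1) :* y) refl
    core : ∀ b .{{_ : ℕ.NonZero b}} .{{_ : ℕ.NonZero (2 ℕ.* b)}} →
           ((+ 2 ℚᵘ./ 1) ℚᵘ.* (+ 1 ℚᵘ./ (2 ℕ.* b))) ℚᵘ.≃ (+ 1 ℚᵘ./ b)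
    core (suc b) = ℚᵘ.*≡* (cong +_ (sym (trans (ℕₚ.+-identityʳ _)
      (ℕₚ.+-identityʳ (2 ℕ.* suc b)))))
    step : toℚᵘ ((+ 2 / 1) * x) ℚᵘ.≃ toℚᵘ (+ 1 / b)
    step = ℚᵘₚ.≃-trans (toℚᵘ-homo-* (+ 2 / 1) x)
          (ℚᵘₚ.≃-trans (ℚᵘₚ.*-cong (frac≃ (+ 2) 1) (frac≃ (+ 1) (2 ℕ.* b)))
          (ℚᵘₚ.≃-trans (core b) (ℚᵘₚ.≃-sym (frac≃ (+ 1) b))))

  below-pos : ∀ {p} → 0ℚ < p → ∃[ n ] + 1 / suc n ≤ p
  below-pos {mkℚ +[1+ a ] d c} _ = d ,
    subst (+ 1 / suc d ≤_) (↥p/↧p≡p (mkℚ +[1+ a ] d c))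
      (≤-frac 1 (suc d) (suc a) (suc d) (ℕₚ.*-monoˡ-≤ (suc d) (s≤s (z≤n {a}))))
  below-pos {mkℚ (+ 0) d c} 0<p =
    ⊥-elim (<⇒≢ 0<p (sym (↥p≡0⇒p≡0 (mkℚ (+ 0) d c) refl)))
  below-pos {mkℚ -[1+ a ] d c} 0<p =
    ⊥-elim (<-irrefl refl (<-trans 0<p (negative⁻¹ (mkℚ -[1+ a ] d c))))

  infixl 7 _×′_
  _×′_ : ℕ → ℚ → ℚ
  zero  ×′ d = 0ℚ
  suc n ×′ d = d + n ×′ d

  ×′-mono : ∀ n {c d} → c ≤ d → n ×′ c ≤ n ×′ d
  ×′-mono zero    c≤d = ≤-refl
  ×′-mono (suc n) c≤d = +-mono-≤ c≤d (×′-mono n c≤d)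

  ×′-* : ∀ n c k → n ×′ c * k ≡ n ×′ (c * k)
  ×′-* zero    c k = *-zeroˡ k
  ×′-* (suc n) c k = trans (*-distribʳ-+ k c (n ×′ c)) (cong (λ z → c * k + z) (×′-* n c k))

  archimedean : ∀ {d} p → 0ℚ < d → ∃[ n ] p ≤ n ×′ d
  archimedean {d} p 0<d with p ≤? 0ℚ
  ... | yes p≤0 = 0 , p≤0
  ... | no p≰0 = suc n , ≤-trans p≤ (×′-mono (suc n) le)
    where
    0<p : 0ℚ < p
    0<p = ≰⇒> p≰0
    sh : ∃[ δ ] 0ℚ < δ × δ ≤ 1ℚ × δ * p ≤ d
    sh = shrink 0<p 0<d
    δ : ℚ
    δ = proj₁ sh
    bp : ∃[ n ] + 1 / suc n ≤ δ
    bp = below-pos (proj₁ (proj₂ sh))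
    n : ℕ
    n = proj₁ bp
    ε : ℚ
    ε = + 1 / suc n
    le : ε * p ≤ d
    le = ≤-trans (*-monoʳ-≤-nonNeg p {{nonNegative (<⇒≤ 0<p)}} (proj₂ bp))
                 (proj₂ (proj₂ (proj₂ sh)))
    add : ∀ m → + m / suc n + ε ≡ + suc m / suc n
    add m = toℚᵘ-injective
      (ℚᵘₚ.≃-trans (toℚᵘ-homo-+ (+ m / suc n) ε)
      (ℚᵘₚ.≃-trans (ℚᵘₚ.+-cong (frac≃ (+ m) (suc n)) (frac≃ (+ 1) (suc n)))
      (ℚᵘₚ.≃-trans (ℚᵘ.*≡* eq) (ℚᵘₚ.≃-sym (frac≃ (+ suc m) (suc n))))))
      where
      N : ℕ
      N = suc n
      eq : (+ m ℤ.* + N ℤ.+ + 1 ℤ.* + N) ℤ.* + N ≡ + suc m ℤ.* (+ N ℤ.* + N)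
      eq = trans (cong (ℤ._* + N) (sym (ℤₚ.*-distribʳ-+ (+ N) (+ m) (+ 1))))
           (trans (ℤₚ.*-assoc (+ m ℤ.+ + 1) (+ N) (+ N))
                  (cong (λ z → + z ℤ.* (+ N ℤ.* + N)) (ℕₚ.+-comm m 1)))
    mult : ∀ m → m ×′ ε ≡ + m / suc n
    mult zero = sym (0/n≡0 (suc n))
    mult (suc m) = trans (cong (λ z → ε + z) (mult m)) (trans (+-comm ε (+ m / suc n)) (add m))
    one : suc n ×′ ε ≡ 1ℚ
    one = trans (mult (suc n)) (toℚᵘ-injective
        (ℚᵘₚ.≃-trans (frac≃ (+ suc n) (suc n)) (ℚᵘ.*≡* (ℤₚ.*-comm (+ suc n) (+ 1)))))
    p≤ : p ≤ suc n ×′ (ε * p)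
    p≤ = ≤-reflexive (trans (sym (*-identityˡ p))
           (trans (cong (_* p) (sym one)) (×′-* (suc n) ε p)))

open Rat

-- Two-sided, rounded, located Dedekind cuts over ℚ: Below r means r < x and
-- Above s means x < s.  Non-negativity of x is the field below-neg.
record ℝ≥0 : Set₁ where
  field
    Below Above     : ℚ → Set
    below-neg       : ∀ {r} → r < 0ℚ → Below r
    above-inhabited : ∃ Above
    below-closed    : ∀ {r s} → r < s → Below s → Below r
    below-open      : ∀ {r} → Below r → ∃[ s ] r < s × Below s
    above-closed    : ∀ {r s} → r < s → Above r → Above s
    above-open      : ∀ {s} → Above s → ∃[ r ] r < s × Above r
    disjoint        : ∀ {r s} → Below r → Above s → r < s
    located         : ∀ {r s} → r < s → Below r ⊎ Above s

  above-nonneg : ∀ {s} → Above s → 0ℚ ≤ s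
  above-nonneg {s} As with 0ℚ ≤? s
  ... | yes 0≤s = 0≤s
  ... | no 0≰s = ⊥-elim (<-irrefl refl (disjoint (below-neg (≰⇒> 0≰s)) As))

  approx : ∀ {δ} → 0ℚ < δ → ∃[ l ] ∃[ u ] Below l × Above u × u < l + δ
  approx {δ} 0<δ =
    let (b , Ab) = above-inhabited
        (h , 0<h , h<δ) = <-dense 0<δ
        (d , 0<d , _ , 2d≤h) = shrink {1ℚ + 1ℚ} (positive⁻¹ (1ℚ + 1ℚ)) 0<h
        (n , ≤nd) = archimedean (b - (- 1ℚ)) 0<d
    in walk b d Ab 0<d (≤-<-trans (≤-trans (≤-reflexive (dbl d)) 2d≤h) h<δ) n (- 1ℚ)
         (below-neg (negative⁻¹ (- 1ℚ)))
         (≤-trans (≤-reflexive (sym (cancelˡ (- 1ℚ) b))) (+-monoʳ-≤ (- 1ℚ) ≤nd))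
    where
    open +-*-Solver using (solve; _:=_; _:+_; _:*_; con)
    dbl : ∀ d → d + d ≡ d * (1ℚ + 1ℚ)
    dbl = solve 1 (λ d → d :+ d := d :* (con 1ℚ :+ con 1ℚ)) refl
    walk : ∀ b d → Above b → 0ℚ < d → d + d < δ → ∀ n l → Below l → b ≤ l + n ×′ d →
           ∃[ l ] ∃[ u ] Below l × Above u × u < l + δ
    walk b d Ab 0<d 2d<δ zero l Bl b≤l = ⊥-elim (<-irrefl refl
      (<-≤-trans (disjoint Bl Ab) (≤-trans b≤l (≤-reflexive (+-identityʳ l)))))
    walk b d Ab 0<d 2d<δ (suc n) l Bl b≤ with located (+-monoʳ-< l (+-pos d 0<d))
    ... | inj₁ Bl′ = walk b d Ab 0<d 2d<δ n (l + d) Bl′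
                       (≤-trans b≤ (≤-reflexive (sym (+-assoc l d (n ×′ d)))))
    ... | inj₂ Au = l , l + (d + d) , Bl , Au , +-monoʳ-< l 2d<δ

open ℝ≥0

infix  4 _≤ᴿ_ _<ᴿ_
infixl 6 _+ᴿ_
infixl 7 _*ᴿ_
infixr 8 _^ᴿ_ _^ℚ_
infixl 8 _^[_/_]

_≤ᴿ_ : ℝ≥0 → ℝ≥0 → Set
x ≤ᴿ y = ∀ {r} → Below x r → Below y r

_<ᴿ_ : ℝ≥0 → ℝ≥0 → Set
x <ᴿ y = ∃[ r ] Above x r × Below y r

fromℚ : (p : ℚ) .{{_ : NonNegative p}} → ℝ≥0
fromℚ p = record
  { Below           = _< p
  ; Above           = p <_
  ; below-neg       = λ r<0 → <-≤-trans r<0 (nonNegative⁻¹ p)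
  ; above-inhabited = p + 1ℚ , +-pos p 1ℚ>0
  ; below-closed    = <-trans
  ; below-open      = λ r<p → let (m , r<m , m<p) = <-dense r<p in m , r<m , m<p
  ; above-closed    = λ r<s p<r → <-trans p<r r<s
  ; above-open      = λ p<s → let (m , p<m , m<s) = <-dense p<s in m , m<s , p<m
  ; disjoint        = <-trans
  ; located         = loc
  }
  where
  loc : ∀ {r s} → r < s → r < p ⊎ p < s
  loc {r} r<s with p ≤? r
  ... | yes p≤r = inj₂ (≤-<-trans p≤r r<s)
  ... | no p≰r = inj₁ (≰⇒> p≰r)

fromℕ : ℕ → ℝ≥0
fromℕ n = fromℚ (+ n / 1) {{normalize-nonNeg n 1}}

_+ᴿ_ : ℝ≥0 → ℝ≥0 → ℝ≥0
x +ᴿ y = record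
  { Below           = Lo
  ; Above           = Up
  ; below-neg       = low
  ; above-inhabited = let (a , Aa) = above-inhabited x ; (b , Ab) = above-inhabited y in
                      a + b + 1ℚ , a , b , Aa , Ab , +-pos (a + b) 1ℚ>0
  ; below-closed    = λ r<s (a , b , Ba , Bb , s<) → a , b , Ba , Bb , <-trans r<s s<
  ; below-open      = λ (a , b , Ba , Bb , r<) →
                      let (m , r<m , m<) = <-dense r< in m , r<m , a , b , Ba , Bb , m<
  ; above-closed    = λ r<s (a , b , Aa , Ab , <r) → a , b , Aa , Ab , <-trans <r r<s
  ; above-open      = λ (a , b , Aa , Ab , <s) →
                      let (m , <m , m<s) = <-dense <s in m , m<s , a , b , Aa , Ab , <m
  ; disjoint        = λ (a , b , Ba , Bb , r<) (c , d , Ac , Ad , <s) →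
                      <-trans r< (<-trans (+-mono-< (disjoint x Ba Ac) (disjoint y Bb Ad)) <s)
  ; located         = loc
  }
  where
  Lo Up : ℚ → Set
  Lo r = ∃[ a ] ∃[ b ] Below x a × Below y b × r < a + b
  Up s = ∃[ a ] ∃[ b ] Above x a × Above y b × a + b < s
  low : ∀ {r} → r < 0ℚ → Lo r
  low {r} r<0 =
    let (m , 0<m , m<) = <-dense (diff-pos r<0)
        (d , 0<d , d<) = <-dense (diff-pos m<)
        -d<0 = subst (- d <_) refl (neg-antimono-< 0<d)
        -m<0 = neg-antimono-< 0<m
    in - m , - d , below-neg x -m<0 , below-neg y -d<0 ,
       subst₂ _<_ (e₁ r) (e₂ m d) (neg-antimono-< (subst (m + d <_) (cancelˡ m (0ℚ - r)) (+-monoʳ-< m d<)))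
    where
    open +-*-Solver using (solve; _:=_; _:+_; :-_; con)
    e₁ : ∀ r → - (0ℚ - r) ≡ r
    e₁ = solve 1 (λ r → :- (con 0ℚ :+ (:- r)) := r) refl
    e₂ : ∀ m d → - (m + d) ≡ - m + - d
    e₂ = solve 2 (λ m d → :- (m :+ d) := (:- m) :+ (:- d)) refl
  loc : ∀ {r s} → r < s → Lo r ⊎ Up s
  loc {r} {s} r<s =
    let (δ , 0<δ , _ , δ2≤) = shrink {1ℚ + 1ℚ} (positive⁻¹ (1ℚ + 1ℚ)) (diff-pos r<s)
        (a , u , Ba , Au , u<) = approx x 0<δ
        (b , v , Bb , Av , v<) = approx y 0<δ
        gap : u + v < a + b + (s - r)
        gap = <-≤-trans (+-mono-< u< v<)
              (≤-trans (≤-reflexive (e a b δ)) (+-monoʳ-≤ (a + b) δ2≤))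
    in case a b Ba Bb u v Au Av gap
    where
    open +-*-Solver using (solve; _:=_; _:+_; _:*_; con)
    e : ∀ a b δ → (a + δ) + (b + δ) ≡ a + b + δ * (1ℚ + 1ℚ)
    e = solve 3 (λ a b δ → (a :+ δ) :+ (b :+ δ) := a :+ b :+ δ :* (con 1ℚ :+ con 1ℚ)) refl
    case : ∀ a b → Below x a → Below y b → ∀ u v → Above x u → Above y v →
           u + v < a + b + (s - r) → Lo r ⊎ Up s
    case a b Ba Bb u v Au Av gap with a + b ≤? r
    ... | yes ≤r = inj₂ (u , v , Au , Av , <-≤-trans gap
                     (≤-trans (+-monoˡ-≤ (s - r) ≤r) (≤-reflexive (cancelˡ r s))))
    ... | no ≰r = inj₁ (a , b , Ba , Bb , ≰⇒> ≰r)

_*ᴿ_ : ℝ≥0 → ℝ≥0 → ℝ≥0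
x *ᴿ y = record
  { Below           = Lo
  ; Above           = Up
  ; below-neg       = inj₁
  ; above-inhabited = let (a , Aa) = above-inhabited x ; (b , Ab) = above-inhabited y in
                      a * b + 1ℚ , a , b , Aa , Ab , +-pos (a * b) 1ℚ>0
  ; below-closed    = λ { r<s (inj₁ s<0) → inj₁ (<-trans r<s s<0)
                        ; r<s (inj₂ (a , b , 0≤a , 0≤b , Ba , Bb , s<)) →
                            inj₂ (a , b , 0≤a , 0≤b , Ba , Bb , <-trans r<s s<) }
  ; below-open      = λ { (inj₁ r<0) → let (m , r<m , m<0) = <-dense r<0 in m , r<m , inj₁ m<0
                        ; (inj₂ (a , b , 0≤a , 0≤b , Ba , Bb , r<)) →
                            let (m , r<m , m<) = <-dense r< in
                            m , r<m , inj₂ (a , b , 0≤a , 0≤b , Ba , Bb , m<) }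
  ; above-closed    = λ r<s (a , b , Aa , Ab , <r) → a , b , Aa , Ab , <-trans <r r<s
  ; above-open      = λ (a , b , Aa , Ab , <s) →
                      let (m , <m , m<s) = <-dense <s in m , m<s , a , b , Aa , Ab , <m
  ; disjoint        = dis
  ; located         = loc
  }
  where
  Lo Up : ℚ → Set
  Lo r = r < 0ℚ ⊎ (∃[ a ] ∃[ b ] 0ℚ ≤ a × 0ℚ ≤ b × Below x a × Below y b × r < a * b)
  Up s = ∃[ a ] ∃[ b ] Above x a × Above y b × a * b < s
  dis : ∀ {r s} → Lo r → Up s → r < s
  dis (inj₁ r<0) (c , d , Ac , Ad , <s) =
    <-trans r<0 (≤-<-trans (*-nonneg (above-nonneg x Ac) (above-nonneg y Ad)) <s)
  dis (inj₂ (a , b , 0≤a , 0≤b , Ba , Bb , r<)) (c , d , Ac , Ad , <s) =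
    <-trans r< (<-trans (*-mono-< 0≤a (disjoint x Ba Ac) 0≤b (disjoint y Bb Ad)) <s)
  loc : ∀ {r s} → r < s → Lo r ⊎ Up s
  loc {r} {s} r<s with 0ℚ ≤? r
  ... | no 0≰r = inj₁ (inj₁ (≰⇒> 0≰r))
  ... | yes 0≤r = go (shrink 0<K (diff-pos r<s))
    where
    open +-*-Solver using (solve; _:=_; _:+_; _:*_; con)
    A B K : ℚ
    A = proj₁ (above-inhabited x)
    B = proj₁ (above-inhabited y)
    K = A + B + 1ℚ
    AA : Above x A
    AA = proj₂ (above-inhabited x)
    AB : Above y B
    AB = proj₂ (above-inhabited y)
    0≤A : 0ℚ ≤ A
    0≤A = above-nonneg x AA
    0≤B : 0ℚ ≤ B
    0≤B = above-nonneg y AB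
    0≤A+B : 0ℚ ≤ A + B
    0≤A+B = subst (_≤ A + B) (+-identityˡ 0ℚ) (+-mono-≤ 0≤A 0≤B)
    A≤A+B : A ≤ A + B
    A≤A+B = subst (_≤ A + B) (+-identityʳ A) (+-monoʳ-≤ A 0≤B)
    B≤A+B : B ≤ A + B
    B≤A+B = subst (_≤ A + B) (+-identityˡ B) (+-monoˡ-≤ B 0≤A)
    A+B<K : A + B < K
    A+B<K = +-pos (A + B) 1ℚ>0
    0<K : 0ℚ < K
    0<K = ≤-<-trans 0≤A+B A+B<K
    s-r≤s : s - r ≤ s
    s-r≤s = subst (s - r ≤_) (+-identityʳ s) (+-monoʳ-≤ s (neg-antimono-≤ 0≤r))
    expand : ∀ a b δ → (a + δ) * (b + δ) ≡ a * b + δ * (a + b + δ)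
    expand = solve 3 (λ a b δ → (a :+ δ) :* (b :+ δ) := a :* b :+ δ :* (a :+ b :+ δ)) refl
    go : ∃[ δ ] 0ℚ < δ × δ ≤ 1ℚ × δ * K ≤ s - r → Lo r ⊎ Up s
    go (δ , 0<δ , δ≤1 , δK≤) = case (approx x 0<δ) (approx y 0<δ)
      where
      δ·<s : ∀ {c} → c < K → δ * c < s
      δ·<s c<K = <-≤-trans (*-monoʳ-<-pos δ {{positive 0<δ}} c<K) (≤-trans δK≤ s-r≤s)
      small : ∀ {l u} → l < 0ℚ → u < l + δ → u < δ
      small {l} l<0 u< = <-trans u< (subst (l + δ <_) (+-identityˡ δ) (+-monoˡ-< δ l<0))
      case : ∃[ l ] ∃[ u ] Below x l × Above x u × u < l + δ →
             ∃[ l ] ∃[ u ] Below y l × Above y u × u < l + δ → Lo r ⊎ Up s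
      case (a , u , Ba , Au , u<) (b , v , Bb , Av , v<) with 0ℚ ≤? a | 0ℚ ≤? b
      ... | no 0≰a | _ = inj₂ (u , B , Au , AB ,
              ≤-<-trans (*-monoʳ-≤-nonNeg B {{nonNegative 0≤B}} (<⇒≤ (small (≰⇒> 0≰a) u<)))
                        (δ·<s (≤-<-trans B≤A+B A+B<K)))
      ... | yes _ | no 0≰b = inj₂ (A , v , AA , Av ,
              ≤-<-trans (*-monoˡ-≤-nonNeg A {{nonNegative 0≤A}} (<⇒≤ (small (≰⇒> 0≰b) v<)))
                        (subst (_< s) (*-comm δ A) (δ·<s (≤-<-trans A≤A+B A+B<K))))
      ... | yes 0≤a | yes 0≤b with a * b ≤? r
      ...   | no ≰r = inj₁ (inj₂ (a , b , 0≤a , 0≤b , Ba , Bb , ≰⇒> ≰r))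
      ...   | yes ≤r = inj₂ (u , v , Au , Av ,
                <-≤-trans (*-mono-< (above-nonneg x Au) u< (above-nonneg y Av) v<)
                (≤-trans (≤-reflexive (expand a b δ))
                (≤-trans (+-mono-≤ ≤r
                            (≤-trans (*-monoˡ-≤-nonNeg δ {{nonNegative (<⇒≤ 0<δ)}}
                                       (+-mono-≤ (+-mono-≤ (<⇒≤ (disjoint x Ba AA))
                                                           (<⇒≤ (disjoint y Bb AB))) δ≤1))
                                     δK≤))
                         (≤-reflexive (cancelˡ r s)))))

_^ᴿ_ : ℝ≥0 → ℕ → ℝ≥0
x ^ᴿ zero  = fromℕ 1
x ^ᴿ suc n = x *ᴿ x ^ᴿ n

_^ℚ_ : ℚ → ℕ → ℚ
p ^ℚ zero  = 1ℚ
p ^ℚ suc n = p * p ^ℚ n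

module Powℚ where

  ^-nonneg : ∀ {a} k → 0ℚ ≤ a → 0ℚ ≤ a ^ℚ k
  ^-nonneg zero    0≤a = <⇒≤ 1ℚ>0
  ^-nonneg (suc k) 0≤a = *-nonneg 0≤a (^-nonneg k 0≤a)

  ^-mono-≤ : ∀ {a b} k → 0ℚ ≤ a → a ≤ b → a ^ℚ k ≤ b ^ℚ k
  ^-mono-≤ zero    0≤a a≤b = ≤-refl
  ^-mono-≤ (suc k) 0≤a a≤b = *-mono-≤₀ 0≤a a≤b (^-nonneg k 0≤a) (^-mono-≤ k 0≤a a≤b)

  ^-mono-< : ∀ {a b} k .{{_ : ℕ.NonZero k}} → 0ℚ ≤ a → a < b → a ^ℚ k < b ^ℚ k
  ^-mono-< (suc zero) {{_}} 0≤a a<b =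
    *-monoˡ-<-pos 1ℚ a<b
  ^-mono-< (suc (suc k)) 0≤a a<b =
    *-mono-< 0≤a a<b (^-nonneg (suc k) 0≤a) (^-mono-< (suc k) 0≤a a<b)

  ^-cancel-< : ∀ {a b} k → 0ℚ ≤ b → a ^ℚ k < b ^ℚ k → a < b
  ^-cancel-< {a} {b} k 0≤b h with b ≤? a
  ... | yes b≤a = ⊥-elim (<-irrefl refl (<-≤-trans h (^-mono-≤ k 0≤b b≤a)))
  ... | no b≰a = ≰⇒> b≰a

  1≤^ : ∀ {a} k → 1ℚ ≤ a → 1ℚ ≤ a ^ℚ k
  1≤^ zero    1≤a = ≤-refl
  1≤^ {a} (suc k) 1≤a = ≤-trans 1≤a (subst (_≤ a * a ^ℚ k) (*-identityʳ a)
    (*-monoˡ-≤-nonNeg a {{nonNegative (≤-trans (<⇒≤ 1ℚ>0) 1≤a)}} (1≤^ k 1≤a)))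

  ≤^ : ∀ {a} k .{{_ : ℕ.NonZero k}} → 1ℚ ≤ a → a ≤ a ^ℚ k
  ≤^ {a} (suc k) 1≤a = subst (_≤ a * a ^ℚ k) (*-identityʳ a)
    (*-monoˡ-≤-nonNeg a {{nonNegative (≤-trans (<⇒≤ 1ℚ>0) 1≤a)}} (1≤^ k 1≤a))

-- The non-negative k-th root: up to rounding, r < root k x iff r < 0 or
-- rᵏ < x, and root k x < s iff 0 ≤ s and x < sᵏ.
root : (k : ℕ) .{{_ : ℕ.NonZero k}} → ℝ≥0 → ℝ≥0
root k x = record
  { Below           = Lo
  ; Above           = Up
  ; below-neg       = inj₁
  ; above-inhabited = up
  ; below-closed    = λ { r<s (inj₁ s<0) → inj₁ (<-trans r<s s<0)
                        ; r<s (inj₂ (a , 0≤a , s<a , Ba)) → inj₂ (a , 0≤a , <-trans r<s s<a , Ba) }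
  ; below-open      = λ { (inj₁ r<0) → let (m , r<m , m<0) = <-dense r<0 in m , r<m , inj₁ m<0
                        ; (inj₂ (a , 0≤a , r<a , Ba)) →
                            let (m , r<m , m<a) = <-dense r<a in m , r<m , inj₂ (a , 0≤a , m<a , Ba) }
  ; above-closed    = λ r<s (a , 0≤a , a<r , Aa) → a , 0≤a , <-trans a<r r<s , Aa
  ; above-open      = λ (a , 0≤a , a<s , Aa) →
                      let (m , a<m , m<s) = <-dense a<s in m , m<s , a , 0≤a , a<m , Aa
  ; disjoint        = dis
  ; located         = loc
  }
  where
  open Powℚ
  Lo Up : ℚ → Set
  Lo r = r < 0ℚ ⊎ (∃[ a ] 0ℚ ≤ a × r < a × Below x (a ^ℚ k))
  Up s = ∃[ a ] 0ℚ ≤ a × a < s × Above x (a ^ℚ k)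
  up : ∃ Up
  up = let (u , Au) = above-inhabited x
           0≤u = above-nonneg x Au
           u<  = +-pos u 1ℚ>0
           1≤  = subst (_≤ u + 1ℚ) (+-identityˡ 1ℚ) (+-monoˡ-≤ 1ℚ 0≤u)
       in u + 1ℚ + 1ℚ , u + 1ℚ , ≤-trans 0≤u (<⇒≤ u<) , +-pos (u + 1ℚ) 1ℚ>0 ,
          above-closed x (<-≤-trans u< (≤^ k 1≤)) Au
  dis : ∀ {r s} → Lo r → Up s → r < s
  dis (inj₁ r<0) (a , 0≤a , a<s , Aa) = <-trans r<0 (≤-<-trans 0≤a a<s)
  dis (inj₂ (a , 0≤a , r<a , Ba)) (b , 0≤b , b<s , Ab) =
    <-trans r<a (<-trans (^-cancel-< k 0≤b (disjoint x Ba Ab)) b<s)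
  loc : ∀ {r s} → r < s → Lo r ⊎ Up s
  loc {r} {s} r<s with 0ℚ ≤? r
  ... | no 0≰r = inj₁ (inj₁ (≰⇒> 0≰r))
  ... | yes 0≤r with <-dense r<s
  ...   | m , r<m , m<s with <-dense m<s
  ...     | t , m<t , t<s with located x (^-mono-< k (≤-trans 0≤r (<⇒≤ r<m)) m<t)
  ...       | inj₁ B = inj₁ (inj₂ (m , ≤-trans 0≤r (<⇒≤ r<m) , r<m , B))
  ...       | inj₂ A = inj₂ (t , ≤-trans 0≤r (<⇒≤ (<-trans r<m m<t)) , t<s , A)

_^[_/_] : ℝ≥0 → ℕ → (k : ℕ) .{{_ : ℕ.NonZero k}} → ℝ≥0
x ^[ p / k ] = root k (x ^ᴿ p)

invFact : ℕ → ℚ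
invFact k = (+ 1 / (k !)) {{k ℕₚ.!≢0}}

-- ∑_{i ≤ k} 1/i!
expSum : ℕ → ℚ
expSum zero    = invFact 0
expSum (suc k) = expSum k + invFact (suc k)

module ExpSum where

  fact-pos : ∀ k → 0ℚ < invFact k
  fact-pos k = frac-pos (k !) {{k ℕₚ.!≢0}}

  suc-mono : ∀ k → expSum k ≤ expSum (suc k)
  suc-mono k = <⇒≤ (+-pos (expSum k) (fact-pos (suc k)))

  mono : ∀ k j → expSum j ≤ expSum (j ℕ.+ k)
  mono k j = subst (λ i → expSum j ≤ expSum i) (ℕₚ.+-comm k j) (go k)
    where
    go : ∀ k → expSum j ≤ expSum (k ℕ.+ j)
    go zero    = ≤-refl
    go (suc k) = ≤-trans (go k) (suc-mono (k ℕ.+ j))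

  halving : ∀ k → invFact (suc (suc k)) + invFact (suc (suc k)) ≤ invFact (suc k)
  halving k = ≤-trans (+-mono-≤ le le) (frac-half d)
    where
    d : ℕ
    d = suc k !
    instance
      d≢0 : ℕ.NonZero d
      d≢0 = suc k ℕₚ.!≢0
      2d≢0 : ℕ.NonZero (2 ℕ.* d)
      2d≢0 = ℕₚ.m*n≢0 2 d
    le : invFact (suc (suc k)) ≤ + 1 / (2 ℕ.* d)
    le = ≤-frac 1 (suc (suc k) !) 1 (2 ℕ.* d) {{suc (suc k) ℕₚ.!≢0}}
           (ℕₚ.*-monoʳ-≤ 1 (ℕₚ.*-monoˡ-≤ d (s≤s (s≤s (z≤n {k})))))

  tail-step : ∀ k → expSum (suc (suc k)) + invFact (suc (suc k)) ≤ expSum (suc k) + invFact (suc k)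
  tail-step k = ≤-trans (≤-reflexive (+-assoc (expSum (suc k)) _ _))
                        (+-monoʳ-≤ (expSum (suc k)) (halving k))

  tail : ∀ k j → expSum (suc (j ℕ.+ k)) + invFact (suc (j ℕ.+ k)) ≤ expSum (suc k) + invFact (suc k)
  tail k zero    = ≤-refl
  tail k (suc j) = ≤-trans (tail-step (j ℕ.+ k)) (tail k j)

  small : ∀ {δ} → 0ℚ < δ → ∃[ k ] invFact (suc k) ≤ δ
  small 0<δ = let (n , le) = below-pos 0<δ in n ,
    ≤-trans (≤-frac 1 (suc n !) 1 (suc n) {{suc n ℕₚ.!≢0}}
      (ℕₚ.*-monoʳ-≤ 1 (n≤n! n))) le
    where
    n≤n! : ∀ n → suc n ℕ.≤ suc n !
    n≤n! n = ℕₚ.m≤m*n (suc n) (n !) {{n ℕₚ.!≢0}}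

  upper : ∀ k j → expSum j ≤ expSum (suc k) + invFact (suc k)
  upper k j = ≤-trans (≤-trans (mono k j) (suc-mono (j ℕ.+ k)))
    (≤-trans (<⇒≤ (+-pos _ (fact-pos (suc (j ℕ.+ k))))) (tail k j))

-- Euler's number, as the supremum of the partial sums of ∑ 1/i!.
euler : ℝ≥0
euler = record
  { Below           = Lo
  ; Above           = Up
  ; below-neg       = λ r<0 → 0 , <-trans r<0 (fact-pos 0)
  ; above-inhabited = c + 1ℚ , c , +-pos c 1ℚ>0 , upper 0
  ; below-closed    = λ r<s (k , s<) → k , <-trans r<s s<
  ; below-open      = λ (k , r<) → let (m , r<m , m<) = <-dense r< in m , r<m , k , m<
  ; above-closed    = λ r<s (a , a<r , ub) → a , <-trans a<r r<s , ub
  ; above-open      = λ (a , a<s , ub) → let (m , a<m , m<s) = <-dense a<s in m , m<s , a , a<m , ub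
  ; disjoint        = λ (k , r<) (a , a<s , ub) → <-trans r< (≤-<-trans (ub k) a<s)
  ; located         = loc
  }
  where
  open ExpSum
  c : ℚ
  c = expSum 1 + invFact 1
  Lo Up : ℚ → Set
  Lo r = ∃[ k ] r < expSum k
  Up s = ∃[ a ] a < s × (∀ k → expSum k ≤ a)
  loc : ∀ {r s} → r < s → Lo r ⊎ Up s
  loc {r} {s} r<s =
    let (m , r<m , m<s) = <-dense r<s
        (k , le) = small (diff-pos r<m)
        up : expSum (suc k) ≤ r → Up s
        up ≤r = m , m<s , λ j → ≤-trans (upper k j)
                  (≤-trans (+-mono-≤ ≤r le) (≤-reflexive (cancelˡ r m)))
    in decide k up (expSum (suc k) ≤? r)
    where
    decide : ∀ k → (expSum (suc k) ≤ r → Up s) → Dec (expSum (suc k) ≤ r) → Lo r ⊎ Up s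
    decide k up (yes ≤r) = inj₂ (up ≤r)
    decide k up (no ≰r)  = inj₁ (suc k , ≰⇒> ≰r)

record Edge (n : ℕ) : Set where
  constructor edge
  field
    lo hi  : Fin n
    .lo<hi : lo Fin.< hi

record K₄-copy (n : ℕ) : Set where
  constructor k₄
  field
    v₁ v₂ v₃ v₄ : Fin n
    v₁<v₂       : v₁ Fin.< v₂
    v₂<v₃       : v₂ Fin.< v₃
    v₃<v₄       : v₃ Fin.< v₄

edges : ∀ {n} → K₄-copy n → List (Edge n)
edges (k₄ a b c d a<b b<c c<d) =
  edge a b a<b ∷ edge a c a<c ∷ edge a d (ℕₚ.<-trans a<c c<d) ∷
  edge b c b<c ∷ edge b d (ℕₚ.<-trans b<c c<d) ∷ edge c d c<d ∷ []
  where
  a<c : a Fin.< c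
  a<c = ℕₚ.<-trans a<b b<c

-- The edges claimed by each player, most recent first.  At the start of a
-- round this determines the whole history of the play (Maker has claimed one
-- edge per round), so a strategy below may depend on the full history.
record Position (n : ℕ) : Set where
  constructor ⟨_,_⟩
  field
    maker breaker : List (Edge n)

open Position

Claimed : ∀ {n} → Position n → Edge n → Set
Claimed pos e = e ∈ maker pos ⊎ e ∈ breaker pos

Full : ∀ {n} → Position n → Set
Full pos = ∀ e → Claimed pos e

makerClaims : ∀ {n} → Edge n → Position n → Position n
makerClaims e ⟨ M , B ⟩ = ⟨ e ∷ M , B ⟩

breakerClaims : ∀ {n} → List (Edge n) → Position n → Position n
breakerClaims es ⟨ M , B ⟩ = ⟨ M , es ++ B ⟩

-- Breaker claims q edges, or all remaining edges if there are fewer than q.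
record LegalResponse {n} (q : ℕ) (pos : Position n) (es : List (Edge n)) : Set where
  field
    distinct  : Unique es
    unclaimed : All (λ e → ¬ Claimed pos e) es
    size      : length es ≡ q ⊎ (length es ℕ.< q × Full (breakerClaims es pos))

-- Maps the position just after a move of Maker to Breaker's answer.
Strategy : ℕ → Set
Strategy n = Position n → List (Edge n)

-- The positions at the start of a round that can arise when Breaker follows σ.
data Reachable {n} (σ : Strategy n) : Position n → Set where
  start : Reachable σ ⟨ [] , [] ⟩
  round : ∀ {pos e} → Reachable σ pos → ¬ Claimed pos e →
          Reachable σ (breakerClaims (σ (makerClaims e pos)) (makerClaims e pos))

BreakerWon : ∀ {n} → Position n → Set
BreakerWon {n} pos = (K : K₄-copy n) → Any (_∈ breaker pos) (edges K)

-- Play is continued until every edge is claimed.  The two players' edges are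
-- disjoint, so Breaker has won a full position exactly when Maker has never
-- completed a copy of K₄.
record Winning {n} (q : ℕ) (σ : Strategy n) : Set where
  field
    legal : ∀ {pos e} → Reachable σ pos → ¬ Claimed pos e →
            LegalResponse q (makerClaims e pos) (σ (makerClaims e pos))
    wins  : ∀ {pos} → Reachable σ pos → Full pos → BreakerWon pos

BreakerHasWinningStrategy : (n q : ℕ) → Set
BreakerHasWinningStrategy n q = ∃[ σ ] Winning {n} q σ

IsThresholdBias : (n q : ℕ) → Set
IsThresholdBias n q =
  BreakerHasWinningStrategy n q × (∀ q′ → BreakerHasWinningStrategy n q′ → q ℕ.≤ q′)

{-# OPTIONS --safe #-}

-- Breaker answers each move of Maker with b + 3c² edges.  The first b edges are
-- chosen greedily against the Erdős–Selfridge type potential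
--   ∑_{u ≠ v} ∏_w (z + φ(uw) φ(wv)),   z = (b + 1)²,
-- where φ is 0, 1 or b + 1 on edges of Breaker, free edges and edges of Maker.
-- The potential after Maker's moves never exceeds (b + 1) n² (z + 1)ⁿ, whereas two
-- vertices with k common neighbours in Maker's graph contribute at least zⁿ 2ᵏ;
-- hence all codegrees stay at most c as soon as (b + 1) n² (z + 1)ⁿ < zⁿ 2ᶜ.
-- A new edge uv of Maker then creates at most 3c² threats: the missing edge is
-- spanned by common neighbours of u and v, or joins u (or v) to a common neighbour
-- of the other end and some w adjacent to both; Breaker claims all of them.
-- As (1 + 1/z)ⁿ is at most about 4^(n/z), codegree c ≈ 2n/b² is achieved, and
-- b ≈ 2n^(2/5) gives the bias (2 + 3/4) n^(2/5).  The claimed constant is ≈ 2.96,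
-- which leaves room for crude estimates.
module Submission where

open import Defs
open import Data.Empty using (⊥-elim)
open import Data.Fin.Base as Fin using (Fin)
import Data.Fin.Properties as Finₚ
open import Data.List.Base
  using (List; []; _∷_; _++_; allFin; concat; concatMap; filter; length; map)
open import Data.List.Extrema.Nat using (argmax; argmax-all; f[⊥]≤f[argmax]; f[xs]≤f[argmax])
import Data.List.Membership.DecPropositional as DecMembership
open import Data.List.Membership.Propositional using (_∈_; _∉_; lose)
open import Data.List.Membership.Propositional.Properties
open import Data.List.Properties
  using (++-assoc; filter-accept; filter-reject; length-++; length-map; length-tabulate; map-++)
open import Data.List.Relation.Binary.Disjoint.Propositional using (Disjoint)
open import Data.List.Relation.Unary.All as All using (All; []; _∷_)
import Data.List.Relation.Unary.All.Properties as Allₚ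
open import Data.List.Relation.Unary.AllPairs as AllPairs using (AllPairs; []; _∷_)
import Data.List.Relation.Unary.AllPairs.Properties as AllPairsₚ
open import Data.List.Relation.Unary.Any as Any using (Any; any?; here; there; _─_)
import Data.List.Relation.Unary.Any.Properties as Anyₚ
open import Data.List.Relation.Unary.Unique.Propositional using (Unique)
import Data.List.Relation.Unary.Unique.Propositional.Properties as Uniqueₚ
import Data.Nat.Base as ℕ
import Data.Nat.Properties as ℕₚ
open import Data.Product using (∃-syntax; _×_; _,_; proj₁; proj₂)
open import Data.Rational.Base using (½)
open import Data.Sum.Base using (_⊎_; inj₁; inj₂)
open import Data.Unit.Base using (tt)
open import Relation.Binary.Definitions using (DecidableEquality; tri<; tri≈; tri>)
open import Relation.Binary.PropositionalEquality
open import Relation.Nullary using (¬_; Dec; yes; no; ¬?; recompute; _×-dec_; _⊎-dec_)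
open import Relation.Nullary.Decidable using (toWitness)

-- Rational lower bounds for non-negative reals

module LowerBound where

  open import Data.Integer.Base as ℤ using (+_)
  import Data.Integer.Properties as ℤₚ
  open import Data.Rational.Base
  open import Data.Rational.Properties
  import Data.Rational.Unnormalised.Base as ℚᵘ
  import Data.Rational.Unnormalised.Properties as ℚᵘₚ
  open Rat
  open Powℚ
  open ℝ≥0

  infix 4 _⊑_

  -- This is p ≤ x: lower cuts are open, so `Below x p` would say p < x and exclude equality.
  _⊑_ : ℚ → ℝ≥0 → Set
  p ⊑ x = ∀ {r} → r < p → Below x r

  ⊑-mono : ∀ {p p′ x} → p ≤ p′ → p′ ⊑ x → p ⊑ x
  ⊑-mono p≤p′ p′⊑x r<p = p′⊑x (<-≤-trans r<p p≤p′)

  ⊑⇒≤Above : ∀ {p} x {s} → p ⊑ x → Above x s → p ≤ s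
  ⊑⇒≤Above {p} x {s} p⊑x As with p ≤? s
  ... | yes p≤s = p≤s
  ... | no p≰s  = ⊥-elim (<-irrefl refl (disjoint x (p⊑x (≰⇒> p≰s)) As))

  ⊑-+ : ∀ {p} x y → p ⊑ x → p ⊑ x +ᴿ y
  ⊑-+ x y p⊑x r<p =
    let (m , r<m , m<p)  = <-dense r<p
        (m′ , m<m′ , m′<p) = <-dense m<p
    -- The summand taken for `y` is the negative number m - m′, which lies below every non-negative
    -- real; the two summands add up to m > r.
    in m′ , m - m′ , p⊑x m′<p ,
       below-neg y (subst (m - m′ <_) (+-inverseʳ m′) (+-monoˡ-< (- m′) m<m′)) ,
       subst (_ <_) (sym (cancelˡ m′ m)) r<m

  -- Explicit lower witnesses for the factors would require a division. Locatedness of the product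
  -- leaves only an upper witness a * b < m to refute, and p ≤ a, q ≤ b do so.
  ⊑-* : ∀ {p q} x y → 0ℚ ≤ p → 0ℚ ≤ q → p ⊑ x → q ⊑ y → p * q ⊑ x *ᴿ y
  ⊑-* {p} {q} x y 0≤p 0≤q p⊑x q⊑y r<pq with <-dense r<pq
  ... | m , r<m , m<pq with located (x *ᴿ y) r<m
  ...   | inj₁ B = B
  ...   | inj₂ (a , b , Aa , Ab , ab<m) = ⊥-elim (<-irrefl refl (<-trans m<pq
            (≤-<-trans (*-mono-≤₀ 0≤p (⊑⇒≤Above x p⊑x Aa) 0≤q (⊑⇒≤Above y q⊑y Ab)) ab<m)))

  ⊑-^ : ∀ {p} x k → 0ℚ ≤ p → p ⊑ x → p ^ℚ k ⊑ x ^ᴿ k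
  ⊑-^ x ℕ.zero    0≤p p⊑x r<1 = r<1
  ⊑-^ x (ℕ.suc k) 0≤p p⊑x = ⊑-* x (x ^ᴿ k) 0≤p (^-nonneg k 0≤p) p⊑x (⊑-^ x k 0≤p p⊑x)

  ⊑-root : ∀ {p} k .{{_ : ℕ.NonZero k}} x → p ^ℚ k ⊑ x → p ⊑ root k x
  ⊑-root {p} k x pᵏ⊑x {r} r<p with 0ℚ ≤? r
  ... | no 0≰r  = inj₁ (≰⇒> 0≰r)
  ... | yes 0≤r with <-dense r<p
  ...   | m , r<m , m<p = inj₂ (m , 0≤m , r<m , pᵏ⊑x (^-mono-< k 0≤m m<p))
    where
    0≤m : 0ℚ ≤ m
    0≤m = ≤-trans 0≤r (<⇒≤ r<m)

  ⊑-power : ∀ {p s} j k .{{_ : ℕ.NonZero k}} x → 0ℚ ≤ s → s ⊑ x → p ^ℚ k ≤ s ^ℚ j →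
            p ⊑ x ^[ j / k ]
  ⊑-power j k x 0≤s s⊑x pᵏ≤sʲ = ⊑-root k (x ^ᴿ j) (⊑-mono {x = x ^ᴿ j} pᵏ≤sʲ (⊑-^ x j 0≤s s⊑x))

  ι : ℕ.ℕ → ℚ
  ι m = + m / 1

  ι-* : ∀ a b → ι a * ι b ≡ ι (a ℕ.* b)
  ι-* a b = toℚᵘ-injective
    (ℚᵘₚ.≃-trans (toℚᵘ-homo-* (ι a) (ι b))
    (ℚᵘₚ.≃-trans (ℚᵘₚ.*-cong (frac≃ (+ a) 1) (frac≃ (+ b) 1))
    (ℚᵘₚ.≃-trans (ℚᵘ.*≡* (cong (ℤ._* + 1) (sym (ℤₚ.pos-* a b))))
                 (ℚᵘₚ.≃-sym (frac≃ (+ (a ℕ.* b)) 1)))))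

  ι-^ : ∀ a k → ι a ^ℚ k ≡ ι (a ℕ.^ k)
  ι-^ a ℕ.zero    = refl
  ι-^ a (ℕ.suc k) = trans (cong (ι a *_) (ι-^ a k)) (ι-* a (a ℕ.^ k))

  ι-mono : ∀ {a b} → a ℕ.≤ b → ι a ≤ ι b
  ι-mono {a} {b} a≤b = ≤-frac a 1 b 1 (ℕₚ.*-monoˡ-≤ 1 a≤b)

  ι-nonneg : ∀ a → 0ℚ ≤ ι a
  ι-nonneg a = ι-mono {0} {a} ℕ.z≤n

  constant : ℝ≥0
  constant = fromℕ 5 ^[ 6 / 5 ] *ᴿ fromℚ ½ ^[ 9 / 5 ] *ᴿ euler ^[ 2 / 5 ]

  -- The factors are at least 55/8, 2/7 and 22/15, whose product is 121/42, about 2.88. With the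
  -- roots cleared, each bound is a decidable comparison of rational powers; e enters through its
  -- partial sum 8/3.
  121/42⊑constant : + 121 / 42 ⊑ constant
  121/42⊑constant =
    ⊑-* (fromℕ 5 ^[ 6 / 5 ] *ᴿ fromℚ ½ ^[ 9 / 5 ]) (euler ^[ 2 / 5 ])
      (toWitness {a? = 0ℚ ≤? + 55 / 8 * (+ 2 / 7)} _) (toWitness {a? = 0ℚ ≤? + 22 / 15} _)
      (⊑-* (fromℕ 5 ^[ 6 / 5 ]) (fromℚ ½ ^[ 9 / 5 ])
        (toWitness {a? = 0ℚ ≤? + 55 / 8} _) (toWitness {a? = 0ℚ ≤? + 2 / 7} _)
        (⊑-power {+ 55 / 8} 6 5 (fromℕ 5) (ι-nonneg 5) (λ r<5 → r<5)
          (toWitness {a? = (+ 55 / 8) ^ℚ 5 ≤? ι 5 ^ℚ 6} _))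
        (⊑-power {+ 2 / 7} 9 5 (fromℚ ½) (toWitness {a? = 0ℚ ≤? ½} _) (λ r<½ → r<½)
          (toWitness {a? = (+ 2 / 7) ^ℚ 5 ≤? ½ ^ℚ 9} _)))
      (⊑-power {+ 22 / 15} 2 5 euler (toWitness {a? = 0ℚ ≤? expSum 3} _) (λ r<e → 3 , r<e)
        (toWitness {a? = (+ 22 / 15) ^ℚ 5 ≤? expSum 3 ^ℚ 2} _))

  -- Reduces the real estimate to natural numbers: p is an integer lower bound for n^(2/5), and
  -- 121/42 replaces the constant.
  ≤-bound : ∀ ε n q p → p ℕ.^ 5 ℕ.≤ n ℕ.^ 2 → 42 ℕ.* q ℕ.≤ 121 ℕ.* p →
            fromℕ q ≤ᴿ (constant +ᴿ ε) *ᴿ fromℕ n ^[ 2 / 5 ]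
  ≤-bound ε n q p p⁵≤n² 42q≤121p = ⊑-mono {x = (constant +ᴿ ε) *ᴿ fromℕ n ^[ 2 / 5 ]} q≤
    (⊑-* (constant +ᴿ ε) (fromℕ n ^[ 2 / 5 ]) (toWitness {a? = 0ℚ ≤? + 121 / 42} _) (ι-nonneg p)
      (⊑-+ constant ε 121/42⊑constant)
      (⊑-power {ι p} 2 5 (fromℕ n) (ι-nonneg n) (λ r<n → r<n)
        (subst₂ _≤_ (sym (ι-^ p 5)) (sym (ι-^ n 2)) (ι-mono p⁵≤n²))))
    where
    q≤ : ι q ≤ + 121 / 42 * ι p
    q≤ = *-cancelˡ-≤-pos (ι 42) (≤-trans (≤-reflexive (ι-* 42 q))
      (≤-trans (ι-mono 42q≤121p) (≤-reflexive (trans (sym (ι-* 121 p))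
        (*-assoc (ι 42) (+ 121 / 42) (ι p))))))

-- The potential

open import Data.Nat.Base hiding (_/_)
open import Data.Nat.ListAction using (product; sum)
open import Data.Nat.ListAction.Properties using (product-++)
open import Data.Nat.Properties
open import Data.Nat.Solver using (module +-*-Solver)
open import Algebra.Properties.CommutativeSemigroup *-commutativeSemigroup
  using (interchange; x∙yz≈y∙xz; xy∙z≈y∙xz)
open +-*-Solver using (solve; _:=_; _:+_; _:*_; _:^_; con)

module Potential {E : Set} (_≟ᴱ_ : DecidableEquality E) where

  open DecMembership _≟ᴱ_ using (_∈?_)

  weight : (E → ℕ) → List E → ℕ
  weight φ b = product (map φ b)

  -- The contribution of a single pair u, v: one factor per block, where in the application a block
  -- holds the edges uw and wv for one vertex w.
  potential : ℕ → (E → ℕ) → List (List E) → ℕ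
  potential z φ []       = 1
  potential z φ (b ∷ bs) = (z + weight φ b) * potential z φ bs

  -- The part of the potential in which the weight of e occurs as a factor.
  danger : ℕ → (E → ℕ) → E → List (List E) → ℕ
  danger z φ e [] = 0
  danger z φ e (b ∷ bs) with e ∈? b
  ... | yes _ = weight φ b * potential z φ bs
  ... | no _  = (z + weight φ b) * danger z φ e bs

  module _ {φ ψ : E → ℕ} where

    weight-mono : ∀ {b} → (∀ {x} → x ∈ b → φ x ≤ ψ x) → weight φ b ≤ weight ψ b
    weight-mono {[]}    φ≤ψ = ≤-refl
    weight-mono {x ∷ b} φ≤ψ =
      *-mono-≤ (φ≤ψ (here refl)) (weight-mono {b} (λ x∈b → φ≤ψ (there x∈b)))

    potential-mono : ∀ z bs → (∀ {x} → x ∈ concat bs → φ x ≤ ψ x) →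
                     potential z φ bs ≤ potential z ψ bs
    potential-mono z []       φ≤ψ = ≤-refl
    potential-mono z (b ∷ bs) φ≤ψ = *-mono-≤
      (+-monoʳ-≤ z (weight-mono {b} (λ x∈b → φ≤ψ (∈-++⁺ˡ x∈b))))
      (potential-mono z bs (λ x∈bs → φ≤ψ (∈-++⁺ʳ b x∈bs)))

    danger-mono : ∀ z e bs → (∀ x → φ x ≤ ψ x) → danger z φ e bs ≤ danger z ψ e bs
    danger-mono z e []       φ≤ψ = ≤-refl
    danger-mono z e (b ∷ bs) φ≤ψ with e ∈? b
    ... | yes _ = *-mono-≤ (weight-mono {b} (λ {x} _ → φ≤ψ x))
                           (potential-mono z bs (λ {x} _ → φ≤ψ x))
    ... | no _  = *-mono-≤ (+-monoʳ-≤ z (weight-mono {b} (λ {x} _ → φ≤ψ x)))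
                           (danger-mono z e bs φ≤ψ)

  weight-zero : ∀ {φ f b} → φ f ≡ 0 → f ∈ b → weight φ b ≡ 0
  weight-zero {φ} {b = x ∷ b} φf≡0 (here refl) = cong (_* weight φ b) φf≡0
  weight-zero {φ} {b = x ∷ b} φf≡0 (there f∈b) =
    trans (cong (φ x *_) (weight-zero φf≡0 f∈b)) (*-zeroʳ (φ x))

  -- Without repetitions in `b`, the raised value of `e` enters the product at most once, so the
  -- factor q + 1 is paid at most once.
  weight-boost : ∀ {φ ψ e b} q → (∀ {x} → x ≢ e → φ x ≤ ψ x) → φ e ≤ suc q * ψ e →
                 Unique b → weight φ b ≤ suc q * weight ψ b
  weight-boost {b = []} _ _ _ _ = m≤m+n 1 _
  weight-boost {φ} {ψ} {e} {x ∷ b} q φ≤ψ φe≤ (x∉b ∷ b!) with x ≟ᴱ e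
  ... | yes refl = ≤-trans
          (*-mono-≤ φe≤ (weight-mono {b = b} (λ y∈b → φ≤ψ (λ y≡x → All.lookup x∉b y∈b (sym y≡x)))))
          (≤-reflexive (*-assoc (suc q) (ψ x) (weight ψ b)))
  ... | no x≢e = ≤-trans (*-mono-≤ (φ≤ψ x≢e) (weight-boost {b = b} q φ≤ψ φe≤ b!))
          (≤-reflexive (x∙yz≈y∙xz (ψ x) (suc q) (weight ψ b)))

  -- The first block containing `f` loses its weight, so its factor drops from z + w to z; the loss
  -- is w times the remaining factors, which is the danger. Elsewhere monotonicity suffices.
  potential-kill : ∀ {φ ψ f} z bs → (∀ x → φ x ≤ ψ x) → φ f ≡ 0 →
                   potential z φ bs + danger z ψ f bs ≤ potential z ψ bs
  potential-kill z [] _ _ = ≤-refl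
  potential-kill {φ} {ψ} {f} z (b ∷ bs) φ≤ψ φf≡0 with f ∈? b
  ... | yes f∈b = begin
    (z + weight φ b) * potential z φ bs + weight ψ b * potential z ψ bs
      ≡⟨ cong (λ w → (z + w) * potential z φ bs + weight ψ b * potential z ψ bs)
              (weight-zero {b = b} φf≡0 f∈b) ⟩
    (z + 0) * potential z φ bs + weight ψ b * potential z ψ bs
      ≤⟨ +-monoˡ-≤ _ (*-mono-≤ (≤-reflexive (+-identityʳ z))
                               (potential-mono z bs (λ {x} _ → φ≤ψ x))) ⟩
    z * potential z ψ bs + weight ψ b * potential z ψ bs
      ≡⟨ *-distribʳ-+ (potential z ψ bs) z (weight ψ b) ⟨
    (z + weight ψ b) * potential z ψ bs ∎
    where open ≤-Reasoning
  ... | no _ = begin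
    (z + weight φ b) * potential z φ bs + (z + weight ψ b) * danger z ψ f bs
      ≤⟨ +-monoˡ-≤ _ (*-monoˡ-≤ (potential z φ bs)
           (+-monoʳ-≤ z (weight-mono {b = b} (λ {x} _ → φ≤ψ x)))) ⟩
    (z + weight ψ b) * potential z φ bs + (z + weight ψ b) * danger z ψ f bs
      ≡⟨ *-distribˡ-+ (z + weight ψ b) (potential z φ bs) (danger z ψ f bs) ⟨
    (z + weight ψ b) * (potential z φ bs + danger z ψ f bs)
      ≤⟨ *-monoʳ-≤ (z + weight ψ b) (potential-kill z bs φ≤ψ φf≡0) ⟩
    (z + weight ψ b) * potential z ψ bs ∎
    where open ≤-Reasoning

  danger≤potential : ∀ z φ e bs → danger z φ e bs ≤ potential z φ bs
  danger≤potential z φ e bs = ≤-trans (m≤n+m _ _)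
    -- Compare with the zero function, at which every edge is killed: the danger is bounded by a
    -- drop of the potential, hence by the potential itself.
    (potential-kill {φ = λ _ → 0} {f = e} z bs (λ _ → z≤n) refl)

  -- By disjointness at most one block contains `e`, and its factor grows to at most z + (q + 1)w =
  -- (z + w) + qw. The surplus qw times the other factors is q times the danger.
  potential-boost : ∀ {φ ψ e} q z bs → (∀ {x} → x ≢ e → φ x ≤ ψ x) → φ e ≤ suc q * ψ e →
                    All Unique bs → AllPairs Disjoint bs →
                    potential z φ bs ≤ potential z ψ bs + q * danger z ψ e bs
  potential-boost q z [] _ _ _ _ = s≤s z≤n
  potential-boost {φ} {ψ} {e} q z (b ∷ bs) φ≤ψ φe≤ (b! ∷ bs!) (b# ∷ bs#) with e ∈? b
  ... | yes e∈b = begin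
    (z + weight φ b) * potential z φ bs
      ≤⟨ *-mono-≤ (+-monoʳ-≤ z (weight-boost {b = b} q φ≤ψ φe≤ b!))
                  (potential-mono z bs (λ x∈bs → φ≤ψ (λ x≡e →
                    All.lookupWith (λ { b#c x∈c → b#c (subst (_∈ b) (sym x≡e) e∈b , x∈c) })
                      b# (∈-concat⁻ bs x∈bs)))) ⟩
    (z + suc q * weight ψ b) * potential z ψ bs
      ≡⟨ expand z q (weight ψ b) (potential z ψ bs) ⟩
    (z + weight ψ b) * potential z ψ bs + q * (weight ψ b * potential z ψ bs) ∎
    where
    open ≤-Reasoning
    expand : ∀ z q w p → (z + suc q * w) * p ≡ (z + w) * p + q * (w * p)
    expand = solve 4 (λ z q w p → (z :+ (con 1 :+ q) :* w) :* p :=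
                                  (z :+ w) :* p :+ q :* (w :* p)) refl
  ... | no e∉b = begin
    (z + weight φ b) * potential z φ bs
      ≤⟨ *-mono-≤ (+-monoʳ-≤ z (weight-mono {b = b} (λ x∈b → φ≤ψ (λ { refl → e∉b x∈b }))))
                  (potential-boost q z bs φ≤ψ φe≤ bs! bs#) ⟩
    (z + weight ψ b) * (potential z ψ bs + q * danger z ψ e bs)
      ≡⟨ expand (z + weight ψ b) (potential z ψ bs) q (danger z ψ e bs) ⟩
    (z + weight ψ b) * potential z ψ bs + q * ((z + weight ψ b) * danger z ψ e bs) ∎
    where
    open ≤-Reasoning
    expand : ∀ w p q d → w * (p + q * d) ≡ w * p + q * (w * d)
    expand = solve 4 (λ w p q d → w :* (p :+ q :* d) := w :* p :+ q :* (w :* d)) refl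

-- Sums over lists

module _ {A : Set} where

  sum-mono : ∀ {f g : A → ℕ} xs → (∀ {x} → x ∈ xs → f x ≤ g x) → sum (map f xs) ≤ sum (map g xs)
  sum-mono []       f≤g = ≤-refl
  sum-mono (x ∷ xs) f≤g = +-mono-≤ (f≤g (here refl)) (sum-mono xs (λ x∈xs → f≤g (there x∈xs)))

  sum-+-* : ∀ (f g : A → ℕ) q xs →
            sum (map (λ x → f x + q * g x) xs) ≡ sum (map f xs) + q * sum (map g xs)
  sum-+-* f g q []       = sym (*-zeroʳ q)
  sum-+-* f g q (x ∷ xs) = trans (cong (f x + q * g x +_) (sum-+-* f g q xs))
                                 (rearrange (f x) q (g x) (sum (map f xs)) (sum (map g xs)))
    where
    rearrange : ∀ a q b s t → a + q * b + (s + q * t) ≡ a + s + q * (b + t)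
    rearrange = solve 5 (λ a q b s t → a :+ q :* b :+ (s :+ q :* t) :=
                                       a :+ s :+ q :* (b :+ t)) refl

  sum-const : ∀ {f : A → ℕ} {m} xs → (∀ {x} → x ∈ xs → f x ≤ m) → sum (map f xs) ≤ length xs * m
  sum-const []       f≤m = z≤n
  sum-const (x ∷ xs) f≤m = +-mono-≤ (f≤m (here refl)) (sum-const xs (λ x∈xs → f≤m (there x∈xs)))

  ≤sum : ∀ {f : A → ℕ} {x xs} → x ∈ xs → f x ≤ sum (map f xs)
  ≤sum {f} {x} {xs = _ ∷ xs} (here refl) = m≤m+n (f x) (sum (map f xs))
  ≤sum {f} {xs = y ∷ xs} (there x∈xs) = ≤-trans (≤sum {f} x∈xs) (m≤n+m _ (f y))

-- Moves

_≟ᴱ_ : ∀ {n} → DecidableEquality (Edge n)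
edge a b _ ≟ᴱ edge c d _ with a Finₚ.≟ c | b Finₚ.≟ d
... | yes refl | yes refl = yes refl
... | no a≢c   | _        = no (λ { refl → a≢c refl })
... | _        | no b≢d   = no (λ { refl → b≢d refl })

-- An unordered pair as a list with at most one entry: neither an orientation nor a proof that the
-- ends differ has to be supplied.
between : ∀ {n} → Fin n → Fin n → List (Edge n)
between a b with Finₚ.<-cmp a b
... | tri< a<b _ _ = edge a b a<b ∷ []
... | tri≈ _ _ _   = []
... | tri> _ _ b<a = edge b a b<a ∷ []

between-< : ∀ {n} {a b : Fin n} (a<b : a Fin.< b) → between a b ≡ edge a b a<b ∷ []
between-< {a = a} {b} a<b with Finₚ.<-cmp a b
... | tri< _ _ _   = refl
... | tri≈ a≮b _ _ = ⊥-elim (a≮b a<b)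
... | tri> a≮b _ _ = ⊥-elim (a≮b a<b)

between-sym : ∀ {n} (a b : Fin n) → between a b ≡ between b a
between-sym a b with Finₚ.<-cmp a b | Finₚ.<-cmp b a
... | tri< _ _ _     | tri> _ _ _     = refl
... | tri≈ _ _ _     | tri≈ _ _ _     = refl
... | tri> _ _ _     | tri< _ _ _     = refl
... | tri< a<b _ _   | tri< _ _ a≮b   = ⊥-elim (a≮b a<b)
... | tri< a<b a≢b _ | tri≈ _ b≡a _   = ⊥-elim (a≢b (sym b≡a))
... | tri≈ _ a≡b _   | tri< _ b≢a _   = ⊥-elim (b≢a (sym a≡b))
... | tri≈ _ a≡b _   | tri> _ b≢a _   = ⊥-elim (b≢a (sym a≡b))
... | tri> _ a≢b _   | tri≈ _ b≡a _   = ⊥-elim (a≢b (sym b≡a))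
... | tri> _ _ b<a   | tri> b≮a _ _   = ⊥-elim (b≮a b<a)

between-length : ∀ {n} (a b : Fin n) → length (between a b) ≤ 1
between-length a b with Finₚ.<-cmp a b
... | tri< _ _ _ = ≤-refl
... | tri≈ _ _ _ = z≤n
... | tri> _ _ _ = ≤-refl

between-unique : ∀ {n} (a b : Fin n) → Unique (between a b)
between-unique a b with Finₚ.<-cmp a b
... | tri< _ _ _ = [] ∷ []
... | tri≈ _ _ _ = []
... | tri> _ _ _ = [] ∷ []

data Joins {n : ℕ} : Edge n → Fin n → Fin n → Set where
  forward  : ∀ {a b} .(a<b : a Fin.< b) → Joins (edge a b a<b) a b
  backward : ∀ {a b} .(a<b : a Fin.< b) → Joins (edge a b a<b) b a

∈between⇒Joins : ∀ {n} {g : Edge n} {a b} → g ∈ between a b → Joins g a b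
∈between⇒Joins {a = a} {b} g∈ with Finₚ.<-cmp a b
∈between⇒Joins (here refl) | tri< a<b _ _ = forward a<b
∈between⇒Joins (here refl) | tri> _ _ b<a = backward b<a

Joins-ends : ∀ {n} {g : Edge n} {a b c d} → Joins g a b → Joins g c d →
             (a ≡ c × b ≡ d) ⊎ (a ≡ d × b ≡ c)
Joins-ends (forward _) (forward _) = inj₁ (refl , refl)
Joins-ends (forward _) (backward _) = inj₂ (refl , refl)
Joins-ends (backward _) (forward _) = inj₂ (refl , refl)
Joins-ends (backward _) (backward _) = inj₁ (refl , refl)

allEdges : ∀ n → List (Edge n)
allEdges n = concatMap (λ a → concatMap (between a) (allFin n)) (allFin n)

∈-concatMap-lose : ∀ {A B : Set} (f : A → List B) {xs x y} → x ∈ xs → y ∈ f x → y ∈ concatMap f xs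
∈-concatMap-lose f x∈xs y∈fx = ∈-concatMap⁺ f (lose x∈xs y∈fx)

∈-allEdges : ∀ {n} (e : Edge n) → e ∈ allEdges n
∈-allEdges {n} (edge a b a<b) =
  ∈-concatMap-lose (λ a → concatMap (between a) (allFin n)) (∈-allFin a)
    (∈-concatMap-lose (between a) (∈-allFin b) e∈)
  where
  lt : a Fin.< b
  lt = recompute (a Finₚ.<? b) a<b
  e∈ : edge a b a<b ∈ between a b
  e∈ = subst (edge a b a<b ∈_) (sym (between-< lt)) (here refl)

open Position
open LegalResponse

module Claiming {n : ℕ} where

  open DecMembership (_≟ᴱ_ {n}) using (_∈?_)

  claimed? : (pos : Position n) (e : Edge n) → Dec (Claimed pos e)
  claimed? pos e = (e ∈? maker pos) ⊎-dec (e ∈? breaker pos)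

  claimed-mono : ∀ es {pos : Position n} {e} → Claimed pos e → Claimed (breakerClaims es pos) e
  claimed-mono es (inj₁ e∈M) = inj₁ e∈M
  claimed-mono es (inj₂ e∈B) = inj₂ (∈-++⁺ʳ es e∈B)

  claimed-new : ∀ {es} {pos : Position n} {e} → e ∈ es → Claimed (breakerClaims es pos) e
  claimed-new e∈es = inj₂ (∈-++⁺ˡ e∈es)

  breakerClaims-++ : ∀ fs es (pos : Position n) →
                     breakerClaims (fs ++ es) pos ≡ breakerClaims fs (breakerClaims es pos)
  breakerClaims-++ fs es ⟨ M , B ⟩ = cong ⟨ M ,_⟩ (++-assoc fs es B)

  legal-[] : ∀ {pos : Position n} → LegalResponse 0 pos []
  legal-[] = record { distinct = [] ; unclaimed = [] ; size = inj₁ refl }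

  legal-full : ∀ {pos : Position n} k → Full pos → LegalResponse k pos []
  legal-full zero    full = legal-[]
  legal-full (suc k) full = record
    { distinct = [] ; unclaimed = [] ; size = inj₂ (s≤s z≤n , full) }

  legal-single : ∀ {pos : Position n} {f} → ¬ Claimed pos f → LegalResponse 1 pos (f ∷ [])
  legal-single f∉ = record { distinct = [] ∷ [] ; unclaimed = f∉ ∷ [] ; size = inj₁ refl }

  full-unclaimed : ∀ {pos : Position n} {es} → Full pos → All (λ e → ¬ Claimed pos e) es → es ≡ []
  full-unclaimed full []             = refl
  full-unclaimed full (e∉ ∷ _) = ⊥-elim (e∉ (full _))

  legal-++ : ∀ {k l} {pos : Position n} {es fs} → LegalResponse k pos es →
             LegalResponse l (breakerClaims es pos) fs → LegalResponse (k + l) pos (fs ++ es)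
  legal-++ {k} {l} {pos} {es} {fs} R S = record
    { distinct  = Uniqueₚ.++⁺ (distinct S) (distinct R)
        (λ (e∈fs , e∈es) → All.lookup (unclaimed S) e∈fs (claimed-new e∈es))
    ; unclaimed = Allₚ.++⁺ (All.map (λ e∉ c → e∉ (claimed-mono es c)) (unclaimed S)) (unclaimed R)
    ; size      = sizes (size R) (size S)
    }
    where
    Rest : Set
    Rest = length (fs ++ es) ≡ k + l ⊎
           (length (fs ++ es) < k + l × Full (breakerClaims (fs ++ es) pos))
    len : length (fs ++ es) ≡ length es + length fs
    len = trans (length-++ fs) (+-comm (length fs) (length es))
    sizes : length es ≡ k ⊎ (length es < k × Full (breakerClaims es pos)) →
            length fs ≡ l ⊎ (length fs < l × Full (breakerClaims fs (breakerClaims es pos))) →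
            Rest
    sizes (inj₁ refl) (inj₁ refl) = inj₁ len
    sizes (inj₁ refl) (inj₂ (fs<l , full)) =
      inj₂ (subst (_< length es + l) (sym len) (+-monoʳ-< (length es) fs<l) ,
            subst Full (sym (breakerClaims-++ fs es pos)) full)
    -- A first batch that falls short has filled the board, so the second batch must be empty.
    sizes (inj₂ (es<k , full)) _ with full-unclaimed full (unclaimed S)
    ... | refl = inj₂ (<-≤-trans es<k (m≤m+n k l) , full)

  most : (h : Edge n → ℕ) (pos : Position n) →
         Full pos ⊎ (∃[ f ] ¬ Claimed pos f × (∀ {e} → ¬ Claimed pos e → h e ≤ h f))
  most h pos = go (filter free? (allEdges n)) refl
    where
    free? : ∀ e → Dec (¬ Claimed pos e)
    free? e = ¬? (claimed? pos e)
    go : ∀ es → filter free? (allEdges n) ≡ es →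
         Full pos ⊎ (∃[ f ] ¬ Claimed pos f × (∀ {e} → ¬ Claimed pos e → h e ≤ h f))
    go [] eq = inj₁ full
      where
      full : Full pos
      full e with claimed? pos e
      ... | yes e∈ = e∈
      ... | no e∉ with () ← subst (e ∈_) eq (∈-filter⁺ free? (∈-allEdges e) e∉)
    go (g ∷ es) eq = inj₂
      ( argmax h g es
      , argmax-all h (free (here refl)) (All.tabulate (λ e∈ → free (there e∈)))
      , top )
      where
      free : ∀ {e} → e ∈ g ∷ es → ¬ Claimed pos e
      free e∈ = proj₂ (∈-filter⁻ free? {xs = allEdges n} (subst (_ ∈_) (sym eq) e∈))
      top : ∀ {e} → ¬ Claimed pos e → h e ≤ h (argmax h g es)
      top {e} e∉ with subst (e ∈_) eq (∈-filter⁺ free? (∈-allEdges e) e∉)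
      ... | here refl  = f[⊥]≤f[argmax] {f = h} g es
      ... | there e∈es = All.lookup (f[xs]≤f[argmax] {f = h} g es) e∈es

-- The greedy strategy

open Claiming

-- The second clause records the disjointness of the players' edges edge by edge, in place of a
-- global invariant on positions.
Held : ∀ {n} → Position n → Edge n → Set
Held pos e = e ∈ maker pos × e ∉ breaker pos

module Greedy {n : ℕ} (b z : ℕ) (pools : List (List (List (Edge n)))) where

  open Potential (_≟ᴱ_ {n})
  open DecMembership (_≟ᴱ_ {n}) using (_∈?_)

  -- Taking the two decisions as arguments allows values at different positions to be compared by
  -- cases. `P` stands for Breaker's claim, which takes precedence, and `Q` for Maker's.
  level : {P Q : Set} → Dec P → Dec Q → ℕ
  level (yes _) _       = 0
  level (no _)  (yes _) = suc b
  level (no _)  (no _)  = 1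

  level-mono : {P P′ Q Q′ : Set} (p : Dec P) (q : Dec Q) (p′ : Dec P′) (q′ : Dec Q′) →
               (P′ → P) → (Q → Q′) → level p q ≤ level p′ q′
  level-mono (yes _) _       _        _        _    _    = z≤n
  level-mono (no ¬p) _       (yes p′) _        P′⇒P _    = ⊥-elim (¬p (P′⇒P p′))
  level-mono (no _)  (yes _) (no _)   (yes _)  _    _    = ≤-refl
  level-mono (no _)  (yes q) (no _)   (no ¬q′) _    Q⇒Q′ = ⊥-elim (¬q′ (Q⇒Q′ q))
  level-mono (no _)  (no _)  (no _)   (yes _)  _    _    = s≤s z≤n
  level-mono (no _)  (no _)  (no _)   (no _)   _    _    = ≤-refl

  level-boost : {P Q Q′ : Set} (p : Dec P) (q : Dec Q) (q′ : Dec Q′) →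
                level p q ≤ suc b * level p q′
  level-boost (yes _) _       _        = z≤n
  level-boost (no _)  (yes _) (yes _)  = m≤m*n (suc b) (suc b)
  level-boost (no _)  (yes _) (no _)   = ≤-reflexive (sym (*-identityʳ (suc b)))
  level-boost (no _)  (no _)  (yes _)  = s≤s z≤n
  level-boost (no _)  (no _)  (no _)   = s≤s z≤n

  value : Position n → Edge n → ℕ
  value pos e = level (e ∈? breaker pos) (e ∈? maker pos)

  value-breaker : ∀ {pos e} → e ∈ breaker pos → value pos e ≡ 0
  value-breaker {pos} {e} e∈B with e ∈? breaker pos
  ... | yes _  = refl
  ... | no e∉B = ⊥-elim (e∉B e∈B)

  value-held : ∀ {pos e} → Held pos e → value pos e ≡ suc b
  value-held {pos} {e} (e∈M , e∉B) with e ∈? breaker pos | e ∈? maker pos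
  ... | yes e∈B | _      = ⊥-elim (e∉B e∈B)
  ... | no _    | yes _  = refl
  ... | no _    | no e∉M = ⊥-elim (e∉M e∈M)

  value-mono : ∀ es pos e → value (breakerClaims es pos) e ≤ value pos e
  value-mono es pos e = level-mono (e ∈? (es ++ breaker pos)) (e ∈? maker pos) (e ∈? breaker pos)
    (e ∈? maker pos) (∈-++⁺ʳ es) (λ e∈M → e∈M)

  value-other : ∀ {e x} pos → x ≢ e → value (makerClaims e pos) x ≤ value pos x
  value-other {e} {x} pos x≢e = level-mono (x ∈? breaker pos) (x ∈? (e ∷ maker pos))
    (x ∈? breaker pos) (x ∈? maker pos) (λ x∈B → x∈B)
    λ { (here x≡e) → ⊥-elim (x≢e x≡e) ; (there x∈M) → x∈M }

  value-claimed : ∀ e pos → value (makerClaims e pos) e ≤ suc b * value pos e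
  value-claimed e pos = level-boost (e ∈? breaker pos) (e ∈? (e ∷ maker pos)) (e ∈? maker pos)

  total : Position n → ℕ
  total pos = sum (map (potential z (value pos)) pools)

  risk : Position n → Edge n → ℕ
  risk pos e = sum (map (danger z (value pos) e) pools)

  total-mono : ∀ es pos → total (breakerClaims es pos) ≤ total pos
  total-mono es pos = sum-mono pools
    (λ {bs} _ → potential-mono z bs (λ {x} _ → value-mono es pos x))

  risk-mono : ∀ es pos e → risk (breakerClaims es pos) e ≤ risk pos e
  risk-mono es pos e = sum-mono pools (λ {bs} _ → danger-mono z e bs (value-mono es pos))

  risk≤total : ∀ pos e → risk pos e ≤ total pos
  risk≤total pos e = sum-mono pools (λ {bs} _ → danger≤potential z (value pos) e bs)

  total-kill : ∀ f pos → total (breakerClaims (f ∷ []) pos) + 1 * risk pos f ≤ total pos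
  total-kill f pos = ≤-trans
    (≤-reflexive (sym (sum-+-* (potential z (value (breakerClaims (f ∷ []) pos)))
                               (danger z (value pos) f) 1 pools)))
    (sum-mono pools (λ {bs} _ → ≤-trans
      (≤-reflexive (cong (potential z (value (breakerClaims (f ∷ []) pos)) bs +_)
                         (*-identityˡ (danger z (value pos) f bs))))
      (potential-kill z bs (value-mono (f ∷ []) pos)
        (value-breaker {breakerClaims (f ∷ []) pos} (here refl)))))

  total-boost : (∀ {bs} → bs ∈ pools → All Unique bs × AllPairs Disjoint bs) →
                ∀ e pos → total (makerClaims e pos) ≤ total pos + b * risk pos e
  total-boost good e pos = ≤-trans
    (sum-mono pools (λ {bs} bs∈ → potential-boost b z bs (value-other pos) (value-claimed e pos)
                                    (proj₁ (good bs∈)) (proj₂ (good bs∈))))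
    (≤-reflexive (sum-+-* (potential z (value pos)) (danger z (value pos) e) b pools))

  -- For k = b this guarantees, by `total-boost`, that the total is at most m after Maker's next
  -- move, whichever free edge she takes.
  Controlled : ℕ → ℕ → Position n → Set
  Controlled k m pos = ∀ {e} → ¬ Claimed pos e → total pos + k * risk pos e ≤ m

  controlled-mono : ∀ {k m} es pos → Controlled k m pos → Controlled k m (breakerClaims es pos)
  controlled-mono {k} es pos ctrl {e} e∉ = ≤-trans
    (+-mono-≤ (total-mono es pos) (*-monoʳ-≤ k (risk-mono es pos e)))
    (ctrl (λ c → e∉ (claimed-mono es c)))

  -- An edge still free at the end of the turn was available at each of the
  -- k choices, hence is at most as dangerous as each of the edges chosen.
  greedy : ∀ k pos → ∃[ es ] LegalResponse k pos es ×
           Controlled k (total pos) (breakerClaims es pos)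
  greedy zero pos = [] , legal-[] , λ _ → ≤-reflexive (+-identityʳ _)
  greedy (suc k) pos with most (risk pos) pos
  ... | inj₁ full = [] , legal-full (suc k) full , λ e∉ → ⊥-elim (e∉ (full _))
  ... | inj₂ (f , f∉ , top) with greedy k (breakerClaims (f ∷ []) pos)
  ...   | es , legal , ctrl = es ++ f ∷ [] ,
            legal-++ (legal-single f∉) legal ,
            subst (Controlled (suc k) (total pos)) (sym eq) ctrl′
    where
    mid end : Position n
    mid = breakerClaims (f ∷ []) pos
    end = breakerClaims es mid
    eq : breakerClaims (es ++ f ∷ []) pos ≡ end
    eq = breakerClaims-++ es (f ∷ []) pos
    ctrl′ : Controlled (suc k) (total pos) end
    ctrl′ {e} e∉ = begin
      total end + (risk end e + k * risk end e)
        ≡⟨ rearrange (total end) (risk end e) (k * risk end e) ⟩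
      (total end + k * risk end e) + risk end e
        ≤⟨ +-mono-≤ (ctrl e∉) (≤-trans (risk-mono es mid e) (risk-mono (f ∷ []) pos e)) ⟩
      total mid + risk pos e
        ≤⟨ +-monoʳ-≤ (total mid)
             (top (λ c → e∉ (claimed-mono es {mid} (claimed-mono (f ∷ []) c)))) ⟩
      total mid + risk pos f
        ≡⟨ cong (total mid +_) (*-identityˡ (risk pos f)) ⟨
      total mid + 1 * risk pos f
        ≤⟨ total-kill f pos ⟩
      total pos ∎
      where
      open ≤-Reasoning
      rearrange : ∀ a r s → a + (r + s) ≡ (a + s) + r
      rearrange = solve 3 (λ a r s → a :+ (r :+ s) := (a :+ s) :+ r) refl

  -- Runs through `L`, skipping edges already claimed, and spends any surplus moves greedily so that
  -- the count is exact. The length condition sits in the conclusion because a legal reply is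
  -- required at every position, even if `L` is too long.
  claimFrom : ∀ k L pos → ∃[ es ] LegalResponse k pos es ×
              (length L ≤ k → ∀ {f} → f ∈ L → Claimed (breakerClaims es pos) f)
  claimFrom k [] pos with greedy k pos
  ... | es , legal , _ = es , legal , λ _ ()
  claimFrom zero (_ ∷ _) pos = [] , legal-[] , λ ()
  claimFrom (suc k) (g ∷ L) pos with claimed? pos g
  ... | yes g∈ with claimFrom (suc k) L pos
  ...   | es , legal , cover = es , legal ,
            λ { _ (here refl) → claimed-mono es g∈ ; L≤k (there f∈) → cover (<⇒≤ L≤k) f∈ }
  claimFrom (suc k) (g ∷ L) pos | no g∉ with claimFrom k L (breakerClaims (g ∷ []) pos)
  ...   | es , legal , cover = es ++ g ∷ [] , legal-++ (legal-single g∉) legal ,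
            λ { _ (here refl) → claimed-new {es = es ++ g ∷ []} (∈-++⁺ʳ es (here refl))
              ; L≤k (there f∈) → subst (λ p → Claimed p _) (sym (breakerClaims-++ es (g ∷ []) pos))
                                   (cover (s≤s⁻¹ L≤k) f∈) }

  -- The greedy edges come first; the further claims can only lower the total and the risks, so the
  -- control obtained from the greedy part survives.
  answer : ∀ l L pos → ∃[ es ] LegalResponse (b + l) pos es ×
           Controlled b (total pos) (breakerClaims es pos) ×
           (length L ≤ l → ∀ {f} → f ∈ L → Claimed (breakerClaims es pos) f)
  answer l L pos with greedy b pos
  ... | es , legal , ctrl with claimFrom l L (breakerClaims es pos)
  ...   | fs , legal′ , cover = fs ++ es , legal-++ legal legal′ ,
            subst (Controlled b (total pos)) (sym eq)
              (controlled-mono {b} fs (breakerClaims es pos) ctrl) ,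
            λ L≤l f∈ → subst (λ p → Claimed p _) (sym eq) (cover L≤l f∈)
    where
    eq : breakerClaims (fs ++ es) pos ≡ breakerClaims fs (breakerClaims es pos)
    eq = breakerClaims-++ fs es pos

-- Threats

─-∈ : ∀ {A : Set} {x y : A} {xs} (i : x ∈ xs) → y ∈ (xs ─ i) → y ∈ xs
─-∈ (here _)  y∈         = there y∈
─-∈ (there i) (here y≡)  = here y≡
─-∈ (there i) (there y∈) = there (─-∈ i y∈)

─-≢ : ∀ {A : Set} {x y : A} {xs} → Unique xs → (i : x ∈ xs) → y ∈ (xs ─ i) → y ≢ x
─-≢ (x∉ ∷ _)  (here refl) y∈          y≡x  = All.lookup x∉ y∈ (sym y≡x)
─-≢ (z∉ ∷ _)  (there i)   (here refl) refl = All.lookup z∉ i refl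
─-≢ (_ ∷ xs!) (there i)   (there y∈)  y≡x  = ─-≢ xs! i y∈ y≡x

length-concatMap-≤ : ∀ {A B : Set} (f : A → List B) {m} xs → (∀ {x} → x ∈ xs → length (f x) ≤ m) →
                     length (concatMap f xs) ≤ length xs * m
length-concatMap-≤ f []       f≤m = z≤n
length-concatMap-≤ f (x ∷ xs) f≤m = ≤-trans (≤-reflexive (length-++ (f x)))
  (+-mono-≤ (f≤m (here refl)) (length-concatMap-≤ f xs (λ x∈xs → f≤m (there x∈xs))))

edges-unique : ∀ {n} (K : K₄-copy n) → Unique (edges K)
edges-unique (k₄ a b c d a<b b<c c<d) =
  (hi b<c ∷ hi b<d ∷ lo a<b ∷ lo a<b ∷ lo a<c ∷ []) ∷
  (hi c<d ∷ lo a<b ∷ lo a<b ∷ lo a<c ∷ []) ∷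
  (lo a<b ∷ lo a<b ∷ lo a<c ∷ []) ∷
  (hi c<d ∷ lo b<c ∷ []) ∷
  (lo b<c ∷ []) ∷
  [] ∷ []
  where
  a<c : a Fin.< c
  a<c = <-trans a<b b<c
  b<d : b Fin.< d
  b<d = <-trans b<c c<d
  lo : ∀ {e f : Edge _} → Edge.lo e Fin.< Edge.lo f → e ≢ f
  lo lt refl = <-irrefl refl lt
  hi : ∀ {e f : Edge _} → Edge.hi e Fin.< Edge.hi f → e ≢ f
  hi lt refl = <-irrefl refl lt

module Adjacency {n : ℕ} where

  open DecMembership (_≟ᴱ_ {n}) using (_∈?_)

  Adjacent : Position n → Fin n → Fin n → Set
  Adjacent pos a b = Any (Held pos) (between a b)

  adjacent? : ∀ pos a b → Dec (Adjacent pos a b)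
  adjacent? pos a b = any? (λ e → (e ∈? maker pos) ×-dec ¬? (e ∈? breaker pos)) (between a b)

  adjacent-sym : ∀ {pos a b} → Adjacent pos a b → Adjacent pos b a
  adjacent-sym {pos} {a} {b} = subst (Any (Held pos)) (between-sym a b)

  adjacent⇒≢ : ∀ {pos a b} → Adjacent pos a b → a ≢ b
  adjacent⇒≢ {a = a} {b} adj a≡b with Finₚ.<-cmp a b
  adjacent⇒≢ adj a≡b | tri< _ a≢b _ = a≢b a≡b
  adjacent⇒≢ adj a≡b | tri> _ a≢b _ = a≢b a≡b
  adjacent⇒≢ ()  a≡b | tri≈ _ _ _

  common : Position n → Fin n → Fin n → List (Fin n)
  common pos u v = filter (λ w → adjacent? pos u w ×-dec adjacent? pos w v) (allFin n)

  ∈-common⁺ : ∀ {pos u v w} → Adjacent pos u w → Adjacent pos w v → w ∈ common pos u v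
  ∈-common⁺ {pos} {u} {v} {w} uw wv =
    ∈-filter⁺ (λ w → adjacent? pos u w ×-dec adjacent? pos w v) (∈-allFin w) (uw , wv)

  ∈-common⁻ : ∀ {pos u v w} → w ∈ common pos u v → Adjacent pos u w × Adjacent pos w v
  ∈-common⁻ {pos} {u} {v} w∈ =
    proj₂ (∈-filter⁻ (λ w → adjacent? pos u w ×-dec adjacent? pos w v) {xs = allFin n} w∈)

  rims triangles : Position n → Fin n → Fin n → List (Edge n)
  rims pos u v = concatMap (λ x → concatMap (between x) (common pos u v)) (common pos u v)
  triangles pos u v = concatMap (λ w → concatMap (between u) (common pos v w)) (common pos u v)

  -- The rims are missing edges opposite to e, the triangles missing edges at an end of e.
  candidates : Position n → Edge n → List (Edge n)
  candidates pos (edge u v _) = rims pos u v ++ triangles pos u v ++ triangles pos v u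

  -- Each of the three families is a double loop over common neighbourhoods of distinct vertices,
  -- with at most one edge per pair. In the inner loop of a triangle the two vertices differ because
  -- they are adjacent.
  length-candidates : ∀ {pos c} → (∀ {u v} → u ≢ v → length (common pos u v) ≤ c) →
                      ∀ e → length (candidates pos e) ≤ c * c + (c * c + c * c)
  length-candidates {pos} {c} small (edge u v u<v) = begin
    length (rims pos u v ++ triangles pos u v ++ triangles pos v u)
      ≡⟨ length-++ (rims pos u v) ⟩
    length (rims pos u v) + length (triangles pos u v ++ triangles pos v u)
      ≡⟨ cong (length (rims pos u v) +_) (length-++ (triangles pos u v)) ⟩
    length (rims pos u v) + (length (triangles pos u v) + length (triangles pos v u))
      ≤⟨ +-mono-≤ (nested (λ x → x) (λ _ → common pos u v) u≢v (λ _ → small u≢v))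
         (+-mono-≤ (nested (λ _ → u) (common pos v) u≢v (λ w∈ → small (v≢ w∈)))
                   (nested (λ _ → v) (common pos u) v≢u (λ w∈ → small (v≢ w∈)))) ⟩
    c * c + (c * c + c * c) ∎
    where
    open ≤-Reasoning
    u≢v : u ≢ v
    u≢v u≡v = <-irrefl (cong Fin.toℕ u≡v) (recompute (u Finₚ.<? v) u<v)
    v≢u : v ≢ u
    v≢u v≡u = u≢v (sym v≡u)
    v≢ : ∀ {u v w} → w ∈ common pos u v → v ≢ w
    v≢ {v = v} {w} w∈ v≡w = adjacent⇒≢ {pos} (proj₂ (∈-common⁻ {pos} w∈)) (sym v≡w)
    nested : ∀ {u v} (g : Fin n → Fin n) (h : Fin n → List (Fin n)) → u ≢ v →
             (∀ {w} → w ∈ common pos u v → length (h w) ≤ c) →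
             length (concatMap (λ w → concatMap (between (g w)) (h w)) (common pos u v)) ≤ c * c
    nested {u} {v} g h u≢v h≤c = ≤-trans
      (length-concatMap-≤ (λ w → concatMap (between (g w)) (h w)) (common pos u v)
        (λ {w} w∈ → ≤-trans
          (length-concatMap-≤ (between (g w)) {1} (h w) (λ {x} _ → between-length (g w) x))
          (≤-trans (≤-reflexive (*-identityʳ _)) (h≤c w∈))))
      (*-monoˡ-≤ c (small u≢v))

  ∈-rims : ∀ {pos u v x y f} → Adjacent pos u x → Adjacent pos x v →
           Adjacent pos u y → Adjacent pos y v → f ∈ between x y → f ∈ rims pos u v
  ∈-rims {pos} {u} {v} {x} ux xv uy yv f∈ =
    ∈-concatMap-lose (λ x → concatMap (between x) (common pos u v)) (∈-common⁺ {pos} ux xv)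
      (∈-concatMap-lose (between x) (∈-common⁺ {pos} uy yv) f∈)

  ∈-triangles : ∀ {pos u v w x f} → Adjacent pos u w → Adjacent pos w v →
                Adjacent pos v x → Adjacent pos x w → f ∈ between u x → f ∈ triangles pos u v
  ∈-triangles {pos} {u} {v} uw wv vx xw f∈ =
    ∈-concatMap-lose (λ w → concatMap (between u) (common pos v w)) (∈-common⁺ {pos} uw wv)
      (∈-concatMap-lose (between u) (∈-common⁺ {pos} vx xw) f∈)

  opposite : ∀ {pos u v x y e f} → Joins e u v → Adjacent pos u x → Adjacent pos x v →
             Adjacent pos u y → Adjacent pos y v → f ∈ between x y → f ∈ candidates pos e
  opposite {pos} (forward _) ux xv uy yv f∈ =
    ∈-++⁺ˡ (∈-rims {pos} ux xv uy yv f∈)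
  opposite {pos} (backward _) ux xv uy yv f∈ =
    ∈-++⁺ˡ (∈-rims {pos} (adj xv) (adj ux) (adj yv) (adj uy) f∈)
    where
    adj : ∀ {a b} → Adjacent pos a b → Adjacent pos b a
    adj = adjacent-sym {pos}

  incident : ∀ {pos u v w x e f} → Joins e u v → Adjacent pos u w → Adjacent pos w v →
             Adjacent pos v x → Adjacent pos x w → f ∈ between u x → f ∈ candidates pos e
  incident {pos} {u} {v} (forward _) uw wv vx xw f∈ =
    ∈-++⁺ʳ (rims pos u v) (∈-++⁺ˡ (∈-triangles {pos} uw wv vx xw f∈))
  incident {pos} {u} {v} (backward _) uw wv vx xw f∈ =
    ∈-++⁺ʳ (rims pos v u) (∈-++⁺ʳ (triangles pos v u) (∈-triangles {pos} uw wv vx xw f∈))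

  -- A copy of K₄ lacking rs. If pq was played last, the missing edge is opposite to it and hence a
  -- rim; any of the other four edges meets the missing edge at r or s and sees it as a triangle
  -- candidate.
  module Diamond {pos} {p q r s : Fin n} (pq : Adjacent pos p q)
                 (pr : Adjacent pos p r) (ps : Adjacent pos p s)
                 (qr : Adjacent pos q r) (qs : Adjacent pos q s)
                 {f} (f∈ : f ∈ between r s) where

    adj : ∀ {a b} → Adjacent pos a b → Adjacent pos b a
    adj = adjacent-sym {pos}

    f∈′ : f ∈ between s r
    f∈′ = subst (f ∈_) (between-sym r s) f∈

    on-pq : ∀ {e} → Joins e p q → f ∈ candidates pos e
    on-pq j = opposite {pos} j pr (adj qr) ps (adj qs) f∈

    on-rp : ∀ {e} → Joins e r p → f ∈ candidates pos e
    on-rp j = incident {pos} j (adj qr) (adj pq) ps (adj qs) f∈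

    on-sp : ∀ {e} → Joins e s p → f ∈ candidates pos e
    on-sp j = incident {pos} j (adj qs) (adj pq) pr (adj qr) f∈′

    on-rq : ∀ {e} → Joins e r q → f ∈ candidates pos e
    on-rq j = incident {pos} j (adj pr) pq qs (adj ps) f∈

    on-sq : ∀ {e} → Joins e s q → f ∈ candidates pos e
    on-sq j = incident {pos} j (adj ps) pq qr (adj pr) f∈′

  -- For each of the six possible missing edges, its ends serve as r, s of a `Diamond` and the other
  -- two vertices as p, q.
  threats-covered : ∀ pos (K : K₄-copy n) {f} (i : f ∈ edges K) → All (Held pos) (edges K ─ i) →
                    All (λ e → f ∈ candidates pos e) (edges K ─ i)
  threats-covered pos (k₄ a b c d a<b b<c c<d) = go
    where
    a<c : a Fin.< c
    a<c = <-trans a<b b<c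
    a<d : a Fin.< d
    a<d = <-trans a<c c<d
    b<d : b Fin.< d
    b<d = <-trans b<c c<d
    up : ∀ {u v} (u<v : u Fin.< v) → Held pos (edge u v u<v) → Adjacent pos u v
    up u<v h = subst (Any (Held pos)) (sym (between-< u<v)) (here h)
    down : ∀ {u v} (u<v : u Fin.< v) → Held pos (edge u v u<v) → Adjacent pos v u
    down u<v h = adjacent-sym {pos} (up u<v h)
    ∈↑ : ∀ {u v} (u<v : u Fin.< v) → edge u v u<v ∈ between u v
    ∈↑ u<v = subst (_ ∈_) (sym (between-< u<v)) (here refl)
    es : List (Edge n)
    es = edges (k₄ a b c d a<b b<c c<d)
    go : ∀ {f} (i : f ∈ es) → All (Held pos) (es ─ i) → All (λ e → f ∈ candidates pos e) (es ─ i)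
    go (here refl) (ac ∷ ad ∷ bc ∷ bd ∷ cd ∷ []) =
      on-rp (forward a<c) ∷ on-rq (forward a<d) ∷ on-sp (forward b<c) ∷
      on-sq (forward b<d) ∷ on-pq (forward c<d) ∷ []
      where open Diamond {pos} {c} {d} {a} {b} (up c<d cd) (down a<c ac) (down b<c bc)
                         (down a<d ad) (down b<d bd) (∈↑ a<b)
    go (there (here refl)) (ab ∷ ad ∷ bc ∷ bd ∷ cd ∷ []) =
      on-rp (forward a<b) ∷ on-rq (forward a<d) ∷ on-sp (backward b<c) ∷
      on-pq (forward b<d) ∷ on-sq (forward c<d) ∷ []
      where open Diamond {pos} {b} {d} {a} {c} (up b<d bd) (down a<b ab) (up b<c bc)
                         (down a<d ad) (down c<d cd) (∈↑ a<c)
    go (there (there (here refl))) (ab ∷ ac ∷ bc ∷ bd ∷ cd ∷ []) =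
      on-rp (forward a<b) ∷ on-rq (forward a<c) ∷ on-pq (forward b<c) ∷
      on-sp (backward b<d) ∷ on-sq (backward c<d) ∷ []
      where open Diamond {pos} {b} {c} {a} {d} (up b<c bc) (down a<b ab) (up b<d bd)
                         (down a<c ac) (up c<d cd) (∈↑ a<d)
    go (there (there (there (here refl)))) (ab ∷ ac ∷ ad ∷ bd ∷ cd ∷ []) =
      on-rp (backward a<b) ∷ on-sp (backward a<c) ∷ on-pq (forward a<d) ∷
      on-rq (forward b<d) ∷ on-sq (forward c<d) ∷ []
      where open Diamond {pos} {a} {d} {b} {c} (up a<d ad) (up a<b ab) (up a<c ac)
                         (down b<d bd) (down c<d cd) (∈↑ b<c)
    go (there (there (there (there (here refl))))) (ab ∷ ac ∷ ad ∷ bc ∷ cd ∷ []) =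
      on-rp (backward a<b) ∷ on-pq (forward a<c) ∷ on-sp (backward a<d) ∷
      on-rq (forward b<c) ∷ on-sq (backward c<d) ∷ []
      where open Diamond {pos} {a} {c} {b} {d} (up a<c ac) (up a<b ab) (up a<d ad)
                         (down b<c bc) (up c<d cd) (∈↑ b<d)
    go (there (there (there (there (there (here refl)))))) (ab ∷ ac ∷ ad ∷ bc ∷ bd ∷ []) =
      on-pq (forward a<b) ∷ on-rp (backward a<c) ∷ on-sp (backward a<d) ∷
      on-rq (backward b<c) ∷ on-sq (backward b<d) ∷ []
      where open Diamond {pos} {a} {b} {c} {d} (up a<b ab) (up a<c ac) (up a<d ad)
                         (up b<c bc) (up b<d bd) (∈↑ c<d)

-- The combined strategy

module Game (n b c : ℕ) where

  open Adjacency {n}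
  open Potential (_≟ᴱ_ {n})
  open DecMembership (_≟ᴱ_ {n}) using (_∈?_)

  z : ℕ
  z = suc b * suc b

  -- For w equal to u or v the list `between u w ++ between w v` would consist of the edge uv in
  -- both cases, so two blocks would meet; these cases are emptied.
  spoke : (u v w : Fin n) → List (Edge n)
  spoke u v w with w Finₚ.≟ u | w Finₚ.≟ v
  ... | yes _ | _     = []
  ... | no _  | yes _ = []
  ... | no _  | no _  = between u w ++ between w v

  -- Empty on the diagonal, where a spoke would list the same edge twice.
  pool : (u v : Fin n) → List (List (Edge n))
  pool u v with u Finₚ.≟ v
  ... | yes _ = []
  ... | no _  = map (spoke u v) (allFin n)

  pools : List (List (List (Edge n)))
  pools = concatMap (λ u → map (pool u) (allFin n)) (allFin n)

  open Greedy {n} b z pools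

  ∈-spoke⁻ : ∀ {u v w g} → g ∈ spoke u v w → w ≢ u × w ≢ v × (Joins g u w ⊎ Joins g w v)
  ∈-spoke⁻ {u} {v} {w} g∈ with w Finₚ.≟ u | w Finₚ.≟ v
  ... | no w≢u | no w≢v with ∈-++⁻ (between u w) g∈
  ...   | inj₁ g∈uw = w≢u , w≢v , inj₁ (∈between⇒Joins g∈uw)
  ...   | inj₂ g∈wv = w≢u , w≢v , inj₂ (∈between⇒Joins g∈wv)

  spoke-unique : ∀ {u v} w → u ≢ v → Unique (spoke u v w)
  spoke-unique {u} {v} w u≢v with w Finₚ.≟ u | w Finₚ.≟ v
  ... | yes _  | _      = []
  ... | no _   | yes _  = []
  ... | no w≢u | no w≢v = Uniqueₚ.++⁺ (between-unique u w) (between-unique w v) disj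
    where
    disj : Disjoint (between u w) (between w v)
    disj (g∈uw , g∈wv) with Joins-ends (∈between⇒Joins g∈uw) (∈between⇒Joins g∈wv)
    ... | inj₁ (u≡w , _) = w≢u (sym u≡w)
    ... | inj₂ (u≡v , _) = u≢v u≡v

  spoke-disjoint : ∀ {u v w w′} → u ≢ v → w ≢ w′ → Disjoint (spoke u v w) (spoke u v w′)
  spoke-disjoint {u} {v} {w} {w′} u≢v w≢w′ (g∈ , g∈′)
    with ∈-spoke⁻ {u} {v} {w} g∈ | ∈-spoke⁻ {u} {v} {w′} g∈′
  ... | w≢u , w≢v , inj₁ j | w′≢u , w′≢v , inj₁ j′ with Joins-ends j j′
  ...   | inj₁ (_ , w≡w′) = w≢w′ w≡w′
  ...   | inj₂ (_ , w≡u)  = w≢u w≡u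
  spoke-disjoint u≢v w≢w′ _
      | w≢u , w≢v , inj₁ j | w′≢u , w′≢v , inj₂ j′ with Joins-ends j j′
  ...   | inj₁ (u≡w′ , _) = w′≢u (sym u≡w′)
  ...   | inj₂ (u≡v , _)  = u≢v u≡v
  spoke-disjoint u≢v w≢w′ _
      | w≢u , w≢v , inj₂ j | w′≢u , w′≢v , inj₁ j′ with Joins-ends j j′
  ...   | inj₁ (w≡u , _)  = w≢u w≡u
  ...   | inj₂ (_ , v≡u)  = u≢v (sym v≡u)
  spoke-disjoint u≢v w≢w′ _
      | w≢u , w≢v , inj₂ j | w′≢u , w′≢v , inj₂ j′ with Joins-ends j j′
  ...   | inj₁ (w≡w′ , _) = w≢w′ w≡w′
  ...   | inj₂ (w≡v , _)  = w≢v w≡v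

  pool-good : ∀ u v → All Unique (pool u v) × AllPairs Disjoint (pool u v)
  pool-good u v with u Finₚ.≟ v
  ... | yes _  = [] , []
  ... | no u≢v = Allₚ.map⁺ (All.tabulate (λ {w} _ → spoke-unique w u≢v)) ,
                 AllPairsₚ.map⁺ (AllPairs.map (spoke-disjoint u≢v) (Uniqueₚ.allFin⁺ n))

  ∈-pools⁻ : ∀ {bs} → bs ∈ pools → ∃[ u ] ∃[ v ] bs ≡ pool u v
  ∈-pools⁻ bs∈ with Any.satisfied (∈-concatMap⁻ (λ u → map (pool u) (allFin n)) {xs = allFin n} bs∈)
  ... | u , bs∈u with ∈-map⁻ (pool u) {xs = allFin n} bs∈u
  ...   | v , _ , bs≡ = u , v , bs≡

  pools-good : ∀ {bs} → bs ∈ pools → All Unique bs × AllPairs Disjoint bs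
  pools-good bs∈ with ∈-pools⁻ bs∈
  ... | u , v , refl = pool-good u v

  length-allFin : length (allFin n) ≡ n
  length-allFin = length-tabulate {n = n} (λ w → w)

  length-pool : ∀ u v → length (pool u v) ≤ n
  length-pool u v with u Finₚ.≟ v
  ... | yes _ = z≤n
  ... | no _  = ≤-reflexive (trans (length-map (spoke u v) (allFin n)) length-allFin)

  length-pools : length pools ≤ n * n
  length-pools = ≤-trans
    (length-concatMap-≤ (λ u → map (pool u) (allFin n)) {n} (allFin n)
      (λ {u} _ → ≤-reflexive (trans (length-map (pool u) (allFin n)) length-allFin)))
    (≤-reflexive (cong (_* n) length-allFin))

  -- Initial value of the potential and its lower bound by codegrees

  initial : Position n
  initial = ⟨ [] , [] ⟩

  weight-initial : ∀ es → weight (value initial) es ≡ 1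
  weight-initial []       = refl
  weight-initial (e ∷ es) = trans (+-identityʳ _) (weight-initial es)

  potential-initial : ∀ bs → potential z (value initial) bs ≡ suc z ^ length bs
  potential-initial []       = refl
  potential-initial (es ∷ bs) = cong₂ _*_
    (trans (cong (z +_) (weight-initial es)) (+-comm z 1)) (potential-initial bs)

  total-initial : total initial ≤ n * n * suc z ^ n
  total-initial = ≤-trans
    (sum-const pools (λ {bs} bs∈ → ≤-trans (≤-reflexive (potential-initial bs))
      (^-monoʳ-≤ (suc z) (short bs∈))))
    (*-monoˡ-≤ (suc z ^ n) length-pools)
    where
    short : ∀ {bs} → bs ∈ pools → length bs ≤ n
    short bs∈ with ∈-pools⁻ bs∈
    ... | u , v , refl = length-pool u v

  weight-adjacent : ∀ {pos u v} → Adjacent pos u v → weight (value pos) (between u v) ≡ suc b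
  weight-adjacent {pos} {u} {v} adj with Finₚ.<-cmp u v
  weight-adjacent {pos} (here h) | tri< _ _ _ = trans (*-identityʳ _) (value-held {pos} h)
  weight-adjacent {pos} (here h) | tri> _ _ _ = trans (*-identityʳ _) (value-held {pos} h)

  weight-spoke : ∀ {pos u v w} → Adjacent pos u w → Adjacent pos w v →
                 weight (value pos) (spoke u v w) ≡ z
  weight-spoke {pos} {u} {v} {w} uw wv with w Finₚ.≟ u | w Finₚ.≟ v
  ... | yes w≡u | _       = ⊥-elim (adjacent⇒≢ {pos} uw (sym w≡u))
  ... | no _    | yes w≡v = ⊥-elim (adjacent⇒≢ {pos} wv w≡v)
  ... | no _    | no _    = begin
    product (map (value pos) (between u w ++ between w v))
      ≡⟨ cong product (map-++ (value pos) (between u w) (between w v)) ⟩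
    product (map (value pos) (between u w) ++ map (value pos) (between w v))
      ≡⟨ product-++ (map (value pos) (between u w)) _ ⟩
    weight (value pos) (between u w) * weight (value pos) (between w v)
      ≡⟨ cong₂ _*_ (weight-adjacent {pos} uw) (weight-adjacent {pos} wv) ⟩
    z ∎
    where open ≡-Reasoning

  -- A spoke held by Maker has weight (b + 1)² = z, so a common neighbour contributes the factor 2z;
  -- every other vertex contributes at least z.
  potential-common : ∀ {pos u v} ws →
    z ^ length ws * 2 ^ length (filter (λ w → adjacent? pos u w ×-dec adjacent? pos w v) ws) ≤
    potential z (value pos) (map (spoke u v) ws)
  potential-common [] = ≤-refl
  potential-common {pos} {u} {v} (w ∷ ws) = go (P? w)
    where
    P? : ∀ w → Dec (Adjacent pos u w × Adjacent pos w v)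
    P? w = adjacent? pos u w ×-dec adjacent? pos w v
    ih : z ^ length ws * 2 ^ length (filter P? ws) ≤ potential z (value pos) (map (spoke u v) ws)
    ih = potential-common {pos} {u} {v} ws
    go : Dec (Adjacent pos u w × Adjacent pos w v) →
         z ^ length (w ∷ ws) * 2 ^ length (filter P? (w ∷ ws)) ≤
         potential z (value pos) (map (spoke u v) (w ∷ ws))
    go (yes p) = begin
      z * z ^ length ws * 2 ^ length (filter P? (w ∷ ws))
        ≡⟨ cong (λ us → z * z ^ length ws * 2 ^ length us) (filter-accept P? p) ⟩
      z * z ^ length ws * (2 * 2 ^ length (filter P? ws))
        ≡⟨ rearrange z (z ^ length ws) (2 ^ length (filter P? ws)) ⟩
      (z + z) * (z ^ length ws * 2 ^ length (filter P? ws))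
        ≤⟨ *-mono-≤ (+-monoʳ-≤ z (≤-reflexive (sym (weight-spoke {pos} (proj₁ p) (proj₂ p))))) ih ⟩
      (z + weight (value pos) (spoke u v w)) * potential z (value pos) (map (spoke u v) ws) ∎
      where
      open ≤-Reasoning
      rearrange : ∀ z p q → z * p * (2 * q) ≡ (z + z) * (p * q)
      rearrange = solve 3 (λ z p q → z :* p :* (con 2 :* q) := (z :+ z) :* (p :* q)) refl
    go (no ¬p) = begin
      z * z ^ length ws * 2 ^ length (filter P? (w ∷ ws))
        ≡⟨ cong (λ us → z * z ^ length ws * 2 ^ length us) (filter-reject P? ¬p) ⟩
      z * z ^ length ws * 2 ^ length (filter P? ws)
        ≡⟨ *-assoc z (z ^ length ws) (2 ^ length (filter P? ws)) ⟩
      z * (z ^ length ws * 2 ^ length (filter P? ws))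
        ≤⟨ *-mono-≤ (m≤m+n z _) ih ⟩
      (z + weight (value pos) (spoke u v w)) * potential z (value pos) (map (spoke u v) ws) ∎
      where open ≤-Reasoning

  total-common : ∀ {pos u v} → u ≢ v → z ^ n * 2 ^ length (common pos u v) ≤ total pos
  total-common {pos} {u} {v} u≢v = begin
    z ^ n * 2 ^ length (common pos u v)
      ≡⟨ cong (λ l → z ^ l * 2 ^ length (common pos u v)) length-allFin ⟨
    z ^ length (allFin n) * 2 ^ length (common pos u v)
      ≤⟨ potential-common {pos} (allFin n) ⟩
    potential z (value pos) (map (spoke u v) (allFin n))
      ≡⟨ cong (potential z (value pos)) pool≡ ⟨
    potential z (value pos) (pool u v)
      ≤⟨ ≤sum {f = potential z (value pos)} pool∈ ⟩
    total pos ∎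
    where
    open ≤-Reasoning
    pool≡ : pool u v ≡ map (spoke u v) (allFin n)
    pool≡ with u Finₚ.≟ v
    ... | yes u≡v = ⊥-elim (u≢v u≡v)
    ... | no _    = refl
    pool∈ : pool u v ∈ pools
    pool∈ = ∈-concatMap-lose (λ u → map (pool u) (allFin n)) (∈-allFin u)
              (∈-map⁺ (pool u) (∈-allFin v))

  -- The factor `suc b` in `budget` pays for Maker's first move, which no greedy choice precedes:
  -- there the risk is bounded only by the total.
  reserve budget : ℕ
  reserve = c * c + (c * c + c * c)
  budget = suc b * (n * n * suc z ^ n)

  -- No threat is open at the start of a round. In particular Maker cannot hold all six edges of a
  -- copy, since each of them would then be Breaker's.
  Guarded : Position n → Set
  Guarded pos = ∀ K {f} (i : f ∈ edges K) → All (Held pos) (edges K ─ i) → f ∈ breaker pos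

  guarded-initial : Guarded initial
  guarded-initial K (here refl) ((() , _) ∷ _)
  guarded-initial K (there _)   ((() , _) ∷ _)

  held-before : ∀ {pos : Position n} {e g} es → g ≢ e →
                Held (breakerClaims es (makerClaims e pos)) g → Held pos g
  held-before es g≢e (here g≡e , _)   = ⊥-elim (g≢e g≡e)
  held-before es g≢e (there g∈M , g∉) = g∈M , λ g∈B → g∉ (∈-++⁺ʳ es g∈B)

  -- If `e` is not among the five held edges, they were held before the move and the old guard
  -- applies. Otherwise `f` is a candidate for `e`, hence claimed after the reply.
  guarded-step : ∀ {pos e} es → ¬ Claimed pos e → Guarded pos →
    (∀ {f} → f ∈ candidates (makerClaims e pos) e →
             Claimed (breakerClaims es (makerClaims e pos)) f) →
    Guarded (breakerClaims es (makerClaims e pos))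
  guarded-step {pos} {e} es e∉ guarded cover K {f} i held with e ∈? (edges K ─ i)
  ... | no e∉K = ∈-++⁺ʳ es (guarded K i
          (All.tabulate (λ g∈ → held-before es (λ { refl → e∉K g∈ }) (All.lookup held g∈))))
  ... | yes j with f ∈? (es ++ breaker pos)
  ...   | yes f∈B = f∈B
  ...   | no f∉B with cover (All.lookup (threats-covered (makerClaims e pos) K i
                               (All.map (λ (g∈M , g∉) → g∈M , λ g∈B → g∉ (∈-++⁺ʳ es g∈B)) held)) j)
  ...     | inj₂ f∈B = f∈B
  -- If `f` is Maker's, she holds all six edges; the five other than `e` were held before the move,
  -- so the old guard gives `e` to Breaker, although it was free.
  ...     | inj₁ f∈M = ⊥-elim (e∉ (inj₂ (guarded K (─-∈ i j) (All.tabulate (λ g∈ →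
            held-before es (─-≢ (edges-unique K) (─-∈ i j) g∈)
              (All.lookup all (─-∈ (─-∈ i j) g∈)))))))
    where
    all : All (Held (breakerClaims es (makerClaims e pos))) (edges K)
    all = Allₚ.─⁻ i (subst (Held _) (Anyₚ.lookup-result i) (f∈M , f∉B)) held

  guarded-full : ∀ {pos} → Guarded pos → Full pos → BreakerWon pos
  guarded-full {pos} guarded full K with any? (_∈? breaker pos) (edges K)
  ... | yes hit = hit
  ... | no ¬hit with All.tabulate {xs = edges K} (λ {g} g∈ → held g∈ (full g))
    where
    held : ∀ {g} → g ∈ edges K → Claimed pos g → Held pos g
    held g∈ (inj₁ g∈M) = g∈M , λ g∈B → ¬hit (lose g∈ g∈B)
    held g∈ (inj₂ g∈B) = ⊥-elim (¬hit (lose g∈ g∈B))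
  ...   | _ ∷ held = here (guarded K (here refl) held)

  -- A strategy sees only the position; Maker's latest edge is the head of her list.
  lastCandidates : Position n → List (Edge n)
  lastCandidates ⟨ [] , _ ⟩           = []
  lastCandidates pos@(⟨ e ∷ _ , _ ⟩) = candidates pos e

  reply : ∀ pos → ∃[ es ] LegalResponse (b + reserve) pos es ×
          Controlled b (total pos) (breakerClaims es pos) ×
          (length (lastCandidates pos) ≤ reserve →
           ∀ {f} → f ∈ lastCandidates pos → Claimed (breakerClaims es pos) f)
  reply pos = answer reserve (lastCandidates pos) pos

  σ : Strategy n
  σ pos = proj₁ (reply pos)

  module _ (large : budget < z ^ n * 2 ^ c) where

    length-common : ∀ {pos u v} → total pos ≤ budget → u ≢ v → length (common pos u v) ≤ c
    length-common {pos} {u} {v} tot u≢v with length (common pos u v) ≤? c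
    ... | yes l≤c = l≤c
    ... | no l≰c  = ⊥-elim (<-irrefl refl (begin-strict
      budget                               <⟨ large ⟩
      z ^ n * 2 ^ c                        ≤⟨ *-monoʳ-≤ (z ^ n) (^-monoʳ-≤ 2 (<⇒≤ (≰⇒> l≰c))) ⟩
      z ^ n * 2 ^ length (common pos u v)  ≤⟨ total-common {pos} u≢v ⟩
      total pos                            ≤⟨ tot ⟩
      budget                               ∎))
      where open ≤-Reasoning

    -- Control bounds the total after Maker's move by `budget`. Hence all codegrees are at most `c`,
    -- the candidates fit into `reserve`, and the guard is kept; the greedy part of the reply
    -- restores control.
    invariant : ∀ {pos} → Reachable σ pos → Controlled b budget pos × Guarded pos
    invariant start = ctrl , guarded-initial
      where
      ctrl : Controlled b budget initial
      ctrl {e} _ = ≤-trans (+-monoʳ-≤ (total initial) (*-monoʳ-≤ b (risk≤total initial e)))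
                           (*-monoʳ-≤ (suc b) total-initial)
    invariant (round {pos} {e} reach e∉) =
      (λ f∉ → ≤-trans (proj₁ (proj₂ (proj₂ A)) f∉) tot) ,
      guarded-step (proj₁ A) e∉ (proj₂ (invariant reach))
        (proj₂ (proj₂ (proj₂ A))
          (length-candidates {pos′} (length-common {pos′} tot) e))
      where
      pos′ : Position n
      pos′ = makerClaims e pos
      A = reply pos′
      tot : total pos′ ≤ budget
      tot = ≤-trans (total-boost pools-good e pos) (proj₁ (invariant reach) e∉)

    breaker-wins : BreakerHasWinningStrategy n (b + reserve)
    breaker-wins = σ , record
      { legal = λ {pos} {e} _ _ → proj₁ (proj₂ (reply (makerClaims e pos)))
      ; wins  = λ reach full → guarded-full (proj₂ (invariant reach)) full
      }

-- Choice of the parameters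

-- Bernoulli's inequality (1 - 1/(m + 1))^j ≥ 1 - j/(m + 1) with denominators cleared; d stands for
-- m + 1 - j.
bernoulli : ∀ m j d → j + d ≡ suc m → suc m ^ j * d ≤ m ^ j * suc m
bernoulli m zero    d eq = ≤-reflexive (cong (1 *_) eq)
bernoulli m (suc j) d eq = begin
  suc m * suc m ^ j * d    ≡⟨ xy∙z≈y∙xz (suc m) (suc m ^ j) d ⟩
  suc m ^ j * (d + m * d)  ≤⟨ *-monoʳ-≤ (suc m ^ j) (+-monoˡ-≤ (m * d) d≤m) ⟩
  suc m ^ j * (m + m * d)  ≡⟨ cong (suc m ^ j *_) (*-suc m d) ⟨
  suc m ^ j * (m * suc d)  ≡⟨ x∙yz≈y∙xz (suc m ^ j) m (suc d) ⟩
  m * (suc m ^ j * suc d)  ≤⟨ *-monoʳ-≤ m (bernoulli m j (suc d) (trans (+-suc j d) eq)) ⟩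
  m * (m ^ j * suc m)      ≡⟨ *-assoc m (m ^ j) (suc m) ⟨
  m * m ^ j * suc m        ∎
  where
  open ≤-Reasoning
  d≤m : d ≤ m
  d≤m = subst (d ≤_) (suc-injective eq) (m≤n+m d j)

-- That is, (1 + 1/m)^j ≤ 2 for positive m: the Bernoulli bound 1 - j/(m + 1) is at least 1/2.
^-suc-≤-double : ∀ m j → j + j ≤ suc m → suc m ^ j ≤ 2 * m ^ j
^-suc-≤-double m j 2j≤ = *-cancelʳ-≤ _ _ (suc m) (begin
  suc m ^ j * suc m        ≡⟨ cong (suc m ^ j *_) eq ⟨
  suc m ^ j * (j + d)      ≤⟨ *-monoʳ-≤ (suc m ^ j) (+-monoˡ-≤ d j≤d) ⟩
  suc m ^ j * (d + d)      ≡⟨ dbl (suc m ^ j) d ⟩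
  2 * (suc m ^ j * d)      ≤⟨ *-monoʳ-≤ 2 (bernoulli m j d eq) ⟩
  2 * (m ^ j * suc m)      ≡⟨ *-assoc 2 (m ^ j) (suc m) ⟨
  2 * m ^ j * suc m        ∎)
  where
  open ≤-Reasoning
  d : ℕ
  d = suc m ∸ j
  eq : j + d ≡ suc m
  eq = m+[n∸m]≡n (≤-trans (m≤m+n j j) 2j≤)
  j≤d : j ≤ d
  j≤d = m+n≤o⇒m≤o∸n j 2j≤
  dbl : ∀ a d → a * (d + d) ≡ 2 * (a * d)
  dbl = solve 2 (λ a d → a :* (d :+ d) := con 2 :* (a :* d)) refl

^-distribʳ-* : ∀ m n o → (m * n) ^ o ≡ m ^ o * n ^ o
^-distribʳ-* m n zero    = refl
^-distribʳ-* m n (suc o) = trans (cong (m * n *_) (^-distribʳ-* m n o))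
                                 (interchange m n (m ^ o) (n ^ o))

^-suc-≤-2^ : ∀ z j y n .{{_ : NonZero z}} → j + j ≤ suc z → n ≤ j * y → suc z ^ n ≤ 2 ^ y * z ^ n
-- The exponent n is padded by t to j * y, so that the power splits into y blocks, each of which
-- costs a factor 2; the padding z ^ t is cancelled afterwards.
^-suc-≤-2^ z j y n 2j≤ n≤ = *-cancelʳ-≤ _ _ (z ^ t) {{m^n≢0 z t}} (begin
  suc z ^ n * z ^ t           ≤⟨ *-monoʳ-≤ (suc z ^ n) (^-monoˡ-≤ t (n≤1+n z)) ⟩
  suc z ^ n * suc z ^ t       ≡⟨ ^-distribˡ-+-* (suc z) n t ⟨
  suc z ^ (n + t)             ≡⟨ cong (suc z ^_) eq ⟩
  suc z ^ (j * y)             ≡⟨ ^-*-assoc (suc z) j y ⟨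
  (suc z ^ j) ^ y             ≤⟨ ^-monoˡ-≤ y (^-suc-≤-double z j 2j≤) ⟩
  (2 * z ^ j) ^ y             ≡⟨ ^-distribʳ-* 2 (z ^ j) y ⟩
  2 ^ y * (z ^ j) ^ y         ≡⟨ cong (2 ^ y *_) (^-*-assoc z j y) ⟩
  2 ^ y * z ^ (j * y)         ≡⟨ cong (λ m → 2 ^ y * z ^ m) eq ⟨
  2 ^ y * z ^ (n + t)         ≡⟨ cong (2 ^ y *_) (^-distribˡ-+-* z n t) ⟩
  2 ^ y * (z ^ n * z ^ t)     ≡⟨ *-assoc (2 ^ y) (z ^ n) (z ^ t) ⟨
  2 ^ y * z ^ n * z ^ t       ∎)
  where
  open ≤-Reasoning
  t : ℕ
  t = j * y ∸ n
  eq : n + t ≡ j * y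
  eq = m+[n∸m]≡n n≤

-- At 256 the left side is about 2^189 and the comparison is evaluated; from there each step at most
-- doubles m^12, because 24 ≤ m + 1.
polynomial<2^ : ∀ t → 8192 * 100 ^ 12 * (t + 256) ^ 12 < 2 ^ (t + 256)
polynomial<2^ zero    = <ᵇ⇒< _ _ tt
polynomial<2^ (suc t) = begin-strict
  a * suc m ^ 12         ≤⟨ *-monoʳ-≤ a (^-suc-≤-double m 12 24≤) ⟩
  a * (2 * m ^ 12)       ≡⟨ x∙yz≈y∙xz a 2 (m ^ 12) ⟩
  2 * (a * m ^ 12)       <⟨ *-monoʳ-< 2 (polynomial<2^ t) ⟩
  2 * 2 ^ m              ∎
  where
  open ≤-Reasoning
  a m : ℕ
  a = 8192 * 100 ^ 12
  m = t + 256
  24≤ : 24 ≤ suc m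
  24≤ = ≤-trans (<ᵇ⇒< 23 257 tt) (s≤s (m≤n+m 256 t))

-- With y = 100(k+1), Breaker plays b + 1 = 8y² and allows codegree c = 101(k+1);
-- the margin k + 1 = c - y absorbs the polynomial factors.
bias-suffices : ∀ k n → 256 ≤ k → n ≤ 32 * (100 * suc k) ^ 5 →
  ∃[ q ] BreakerHasWinningStrategy n q × 42 * q ≤ 121 * (4 * (100 * k * (100 * k)))
bias-suffices k n 256≤k n≤ = q , Game.breaker-wins n b c large , q≤
  where
  open ≤-Reasoning
  x y l b c q : ℕ
  x = suc k
  y = 100 * x
  l = 8 * (y * y)
  b = pred l
  c = y + x
  q = b + (c * c + (c * c + c * c))
  instance
    y≢0 : NonZero y
    y≢0 = m*n≢0 100 x
    yy≢0 : NonZero (y * y)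
    yy≢0 = m*n≢0 y y
    l≢0 : NonZero l
    l≢0 = m*n≢0 8 (y * y)
    ll≢0 : NonZero (l * l)
    ll≢0 = m*n≢0 l l
  b+1 : suc b ≡ l
  b+1 = suc-pred l
  -- Half of z = (8y²)² = 64y⁴, the largest exponent that `^-suc-≤-double` admits; j * y = 32y⁵ then
  -- covers n.
  j : ℕ
  j = 32 * y ^ 4
  2j≡ : j + j ≡ l * l
  2j≡ = solve 1 (λ y → con 32 :* y :^ 4 :+ con 32 :* y :^ 4 :=
                       con 8 :* (y :* y) :* (con 8 :* (y :* y))) refl y
  jy≡ : 32 * y ^ 5 ≡ j * y
  jy≡ = solve 1 (λ y → con 32 :* y :^ 5 := con 32 :* y :^ 4 :* y) refl y
  poly : l * (n * n) < 2 ^ x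
  poly = begin-strict
    l * (n * n)
      ≤⟨ *-monoʳ-≤ l (*-mono-≤ n≤ n≤) ⟩
    l * (32 * y ^ 5 * (32 * y ^ 5))
      ≡⟨ solve 1 (λ y → con 8 :* (y :* y) :* (con 32 :* y :^ 5 :* (con 32 :* y :^ 5)) :=
                        con 8192 :* y :^ 12) refl y ⟩
    8192 * y ^ 12
      ≡⟨ cong (8192 *_) (^-distribʳ-* 100 x 12) ⟩
    8192 * (100 ^ 12 * x ^ 12)
      ≡⟨ *-assoc 8192 (100 ^ 12) (x ^ 12) ⟨
    8192 * 100 ^ 12 * x ^ 12
      <⟨ subst (λ m → 8192 * 100 ^ 12 * m ^ 12 < 2 ^ m) (m∸n+n≡m (m≤n⇒m≤1+n 256≤k))
               (polynomial<2^ (x ∸ 256)) ⟩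
    2 ^ x ∎
  large′ : l * (n * n * suc (l * l) ^ n) < (l * l) ^ n * 2 ^ c
  large′ = begin-strict
    l * (n * n * suc (l * l) ^ n)
      ≡⟨ *-assoc l (n * n) (suc (l * l) ^ n) ⟨
    l * (n * n) * suc (l * l) ^ n
      <⟨ *-monoˡ-< (suc (l * l) ^ n) {{m^n≢0 (suc (l * l)) n}} poly ⟩
    2 ^ x * suc (l * l) ^ n
      ≤⟨ *-monoʳ-≤ (2 ^ x) (^-suc-≤-2^ (l * l) j y n
           (m≤n⇒m≤1+n (≤-reflexive 2j≡)) (≤-trans n≤ (≤-reflexive jy≡))) ⟩
    2 ^ x * (2 ^ y * (l * l) ^ n)
      ≡⟨ rearrange (2 ^ x) (2 ^ y) ((l * l) ^ n) ⟩
    (l * l) ^ n * (2 ^ y * 2 ^ x)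
      ≡⟨ cong ((l * l) ^ n *_) (^-distribˡ-+-* 2 y x) ⟨
    (l * l) ^ n * 2 ^ c ∎
    where
    rearrange : ∀ a b c → a * (b * c) ≡ c * (b * a)
    rearrange = solve 3 (λ a b c → a :* (b :* c) := c :* (b :* a)) refl
  large : Game.budget n b c < Game.z n b c ^ n * 2 ^ c
  large = subst (λ m → m * (n * n * suc (m * m) ^ n) < (m * m) ^ n * 2 ^ c) (sym b+1) large′
  square : ∀ a m → (a * m) * (a * m) ≡ a * a * (m * m)
  square = solve 2 (λ a m → (a :* m) :* (a :* m) := a :* a :* (m :* m)) refl
  c≡ : c ≡ 101 * x
  c≡ = +-comm y x
  -- Passing from k + 1 to k costs a factor of at most 257/256, by 256 ≤ k.
  256x≤257k : 256 * x ≤ 257 * k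
  256x≤257k = ≤-trans (≤-reflexive (*-suc 256 k)) (+-monoˡ-≤ (256 * k) 256≤k)
  q≤xx : 42 * q ≤ 4645326 * (x * x)
  q≤xx = begin
    42 * (b + (c * c + (c * c + c * c)))
      ≤⟨ *-monoʳ-≤ 42 (+-monoˡ-≤ _ (≤-trans (n≤1+n b) (≤-reflexive b+1))) ⟩
    42 * (8 * (y * y) + (c * c + (c * c + c * c)))
      ≡⟨ cong₂ (λ s t → 42 * (8 * s + (t + (t + t)))) (square 100 x)
               (trans (cong (λ m → m * m) c≡) (square 101 x)) ⟩
    42 * (8 * (10000 * (x * x)) + (10201 * (x * x) + (10201 * (x * x) + 10201 * (x * x))))
      ≡⟨ factor 42 8 10000 10201 (x * x) ⟩
    4645326 * (x * x) ∎
    where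
    factor : ∀ m a b c x → m * (a * (b * x) + (c * x + (c * x + c * x))) ≡
                           m * (a * b + (c + (c + c))) * x
    factor = solve 5 (λ m a b c x → m :* (a :* (b :* x) :+ (c :* x :+ (c :* x :+ c :* x))) :=
                                    m :* (a :* b :+ (c :+ (c :+ c))) :* x) refl
  -- Chains u/v ≤ r/p and r/p ≤ d/a without fractions.
  rescale : ∀ p {r a d u v} .{{_ : NonZero p}} → p * u ≤ r * v → a * r ≤ d * p → a * u ≤ d * v
  rescale p {r} {a} {d} {u} {v} pu≤rv ar≤dp = *-cancelˡ-≤ p (begin
    p * (a * u)  ≡⟨ x∙yz≈y∙xz p a u ⟩
    a * (p * u)  ≤⟨ *-monoʳ-≤ a pu≤rv ⟩
    a * (r * v)  ≡⟨ *-assoc a r v ⟨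
    a * r * v    ≤⟨ *-monoˡ-≤ v ar≤dp ⟩
    d * p * v    ≡⟨ xy∙z≈y∙xz d p v ⟩
    p * (d * v)  ∎)
  q≤ : 42 * q ≤ 121 * (4 * (100 * k * (100 * k)))
  q≤ = begin
    42 * q
      ≤⟨ q≤xx ⟩
    4645326 * (x * x)
      -- Here 65536 = 256², 66049 = 257², 4645326 = 42(8 · 100² + 3 · 101²) and 4840000 = 121 · 4 ·
      -- 100².
      ≤⟨ rescale 65536 {66049} {4645326} {4840000} {x * x} {k * k}
           (subst₂ _≤_ (square 256 x) (square 257 k) (*-mono-≤ 256x≤257k 256x≤257k))
           (≤ᵇ⇒≤ _ _ tt) ⟩
    4840000 * (k * k)
      ≡⟨ expand 121 4 100 k ⟩
    121 * (4 * (100 * k * (100 * k))) ∎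
    where
    expand : ∀ a b c k → a * b * (c * c) * (k * k) ≡ a * (b * (c * k * (c * k)))
    expand = solve 4 (λ a b c k → a :* b :* (c :* c) :* (k :* k) :=
                                  a :* (b :* (c :* k :* (c :* k)))) refl

-- Passage to arbitrary large n

scale : ℕ → ℕ
scale k = 32 * (100 * k) ^ 5

≤scale : ∀ k → k ≤ scale k
≤scale zero      = z≤n
≤scale k@(suc _) = begin
  k                  ≤⟨ m≤n*m k 100 ⟩
  100 * k            ≡⟨ ^-identityʳ (100 * k) ⟨
  (100 * k) ^ 1      ≤⟨ ^-monoʳ-≤ (100 * k) {{m*n≢0 100 k}} {1} {5} (s≤s z≤n) ⟩
  (100 * k) ^ 5      ≤⟨ m≤n*m ((100 * k) ^ 5) 32 ⟩
  32 * (100 * k) ^ 5 ∎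
  where open ≤-Reasoning

-- A discrete intermediate value argument: search upwards from k for the first successor value that
-- reaches n, which happens within d steps.
crossing : ∀ (f : ℕ → ℕ) n d k → f k < n → n ≤ f (d + k) →
           ∃[ m ] k ≤ m × f m < n × n ≤ f (suc m)
crossing f n zero    k fk<n n≤ = ⊥-elim (<-irrefl refl (<-≤-trans fk<n n≤))
crossing f n (suc d) k fk<n n≤ with n ≤? f (suc k)
... | yes n≤f = k , ≤-refl , fk<n , n≤f
... | no n≰f with crossing f n d (suc k) (≰⇒> n≰f) (subst (λ m → n ≤ f m) (sym (+-suc d k)) n≤)
...   | m , k<m , fm<n , n≤f = m , <⇒≤ k<m , fm<n , n≤f

scale-crossing : ∀ n → scale 256 < n → ∃[ k ] 256 ≤ k × scale k < n × n ≤ scale (suc k)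
scale-crossing n lt = crossing scale n n 256 lt (≤-trans (m≤m+n n 256) (≤scale (n + 256)))

-- This makes `scale k` to the power 2/5 the integer 4(100k)², the value used for p in `≤-bound`.
scale² : ∀ k → (4 * (100 * k * (100 * k))) ^ 5 ≡ scale k ^ 2
scale² k = solve 1 (λ t → (con 4 :* (t :* t)) :^ 5 := (con 32 :* t :^ 5) :^ 2) refl (100 * k)

open LowerBound using (≤-bound)

theorem1p9 : (ε : ℝ≥0) → fromℕ 0 <ᴿ ε →
    ∃[ N ] ((n : ℕ) → N ≤ n → (q : ℕ) → IsThresholdBias n q →
    fromℕ q ≤ᴿ
    (fromℕ 5 ^[ 6 / 5 ] *ᴿ fromℚ ½ ^[ 9 / 5 ] *ᴿ euler ^[ 2 / 5 ] +ᴿ ε)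
    *ᴿ fromℕ n ^[ 2 / 5 ])
theorem1p9 ε _ = suc (scale 256) , λ n N≤n q (_ , least) →
  -- The upper end n ≤ `scale (suc k)` makes Breaker's strategy work for n, while the lower end
  -- `scale k` < n shows that its bias is small enough; minimality of the threshold bias transfers
  -- the bound to q.
  let (k , 256≤k , <n , n≤) = scale-crossing n N≤n
      (q′ , win , 42q′≤)    = bias-suffices k n 256≤k n≤
  in ≤-bound ε n q (4 * (100 * k * (100 * k)))
       (≤-trans (≤-reflexive (scale² k)) (^-monoˡ-≤ 2 (<⇒≤ <n)))
       (≤-trans (*-monoʳ-≤ 42 (least q′ win)) 42q′≤)
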